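{- Let $G$ and $H$ be two hamiltonian decomposable digraphs such that $|V(G)|$ is even, $|V(H)|>3$, and $H$ is neither a directed cycle nor a complete symmetric digraph. Then the wreath product $G\wr H$ is hamiltonian decomposable, except possibly when all three of the following hold: $G$ is a directed cycle, $|V(H)|$ is even, and $H$ admits a decomposition into an odd number of directed hamiltonian cycles. (That is, whenever at least one of these three conditions fails, $G\wr H$ is hamiltonian decomposable.)
   Context: All digraphs are finite and strict (no loops and no repeated arcs; a pair of opposite arcs $(x,y),(y,x)$ is allowed, so a directed cycle of length 2 is allowed). The wreath product $G\wr H$ of digraphs $G$ and $H$ is the digraph on vertex set $V(G)\times V(H)$ with an arc from $(g_1,h_1)$ to $(g_2,h_2)$ if and only if there is an arc from $g_1$ to $g_2$ in $G$, or $g_1=g_2$ and there is an arc from $h_1$ to $h_2$ in $H$. A decomposition of a digraph $G$ is a set of pairwise arc-disjoint subdigraphs of $G$ whose arc sets have union $A(G)$. A digraph is hamiltonian decomposable if it admits a decomposition into (one or more) directed hamiltonian cycles. The complete symmetric digraph on $m$ vertices has all arcs $(x,y)$ with $x\neq y$. -}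

module Defs where

open import Data.Fin.Base using (Fin; suc; toℕ)
open import Data.Fin.Properties using (*↔×; inj⇒≟)
open import Data.Nat.Base using (ℕ; suc; _*_; _≤_)
open import Data.Nat.Divisibility using (_∣_)
open import Data.Nat.DivMod using (_mod_)
open import Data.Product.Base using (Σ-syntax; ∃-syntax; _×_; _,_; proj₁; proj₂)
open import Data.Product.Function.NonDependent.Propositional using (_×-↔_)
open import Data.Sum.Base using (_⊎_; inj₁; inj₂)
open import Function.Bundles using (_↔_; _⇔_; Inverse)
open import Function.Construct.Composition using (_↔-∘_)
open import Function.Properties.Inverse using (↔-sym; ↔⇒↣)
open import Level using (0ℓ)
open import Relation.Binary.Core using (Rel)
open import Relation.Binary.Definitions using (Decidable; DecidableEquality)
open import Relation.Binary.PropositionalEquality.Core using (_≡_; _≢_)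
open import Relation.Nullary.Decidable.Core using (_×-dec_; _⊎-dec_)
open import Relation.Nullary.Negation.Core using (¬_)

-- Only inhabitation of `x ⟶ y` is ever used, so there are no repeated arcs.

record Digraph : Set₁ where
  infix 4 _⟶_ _⟶?_
  field
    V           : Set
    order       : ℕ
    enumeration : Fin order ↔ V
    _⟶_         : Rel V 0ℓ
    _⟶?_        : Decidable _⟶_
    loopless    : ∀ {x} → ¬ (x ⟶ x)

  _≟_ : DecidableEquality V
  _≟_ = inj⇒≟ (↔⇒↣ (↔-sym enumeration))

open Digraph using (V; order)

_[_⟶_] : (G : Digraph) → Rel (V G) 0ℓ
G [ x ⟶ y ] = Digraph._⟶_ G x y

infixr 7 _≀_

_≀_ : Digraph → Digraph → Digraph
G ≀ H = record
  { V           = G.V × H.V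
  ; order       = G.order * H.order
  ; enumeration = (G.enumeration ×-↔ H.enumeration) ↔-∘ *↔×
  ; _⟶_         = λ (g₁ , h₁) (g₂ , h₂) → (g₁ G.⟶ g₂) ⊎ (g₁ ≡ g₂ × h₁ H.⟶ h₂)
  ; _⟶?_        = λ (g₁ , h₁) (g₂ , h₂) →
                    (g₁ G.⟶? g₂) ⊎-dec ((g₁ G.≟ g₂) ×-dec (h₁ H.⟶? h₂))
  ; loopless    = λ { (inj₁ g⟶g)       → G.loopless g⟶g
                    ; (inj₂ (_ , h⟶h)) → H.loopless h⟶h }
  }
  where
  module G = Digraph G
  module H = Digraph H

IsCompleteSymmetric : Digraph → Set
IsCompleteSymmetric G = ∀ {x y : V G} → x ≢ y → G [ x ⟶ y ]

next : ∀ {n} → Fin n → Fin n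
next {suc n} i = suc (toℕ i) mod suc n

-- A directed cycle through all elements of A, given by listing them in cyclic
-- order. The lists that differ by a rotation have the same arcs. Length 1 would
-- give a loop, whereas length 2 gives a pair of opposite arcs.

record SpanningCycle (A : Set) : Set where
  field
    length   : ℕ
    2≤length : 2 ≤ length
    vertices : Fin length ↔ A

  vertex : Fin length → A
  vertex = Inverse.to vertices

  Arc : Rel A 0ℓ
  Arc x y = ∃[ i ] (vertex i ≡ x × vertex (next i) ≡ y)

open SpanningCycle using (Arc)

IsDirectedCycle : Digraph → Set
IsDirectedCycle G =
  Σ[ C ∈ SpanningCycle (V G) ] (∀ {x y} → G [ x ⟶ y ] ⇔ Arc C x y)

HamiltonianCycle : Digraph → Set
HamiltonianCycle G =
  Σ[ C ∈ SpanningCycle (V G) ] (∀ {x y} → Arc C x y → G [ x ⟶ y ])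

-- A decomposition of G into exactly k directed hamiltonian cycles.

record HamiltonianDecomposition (G : Digraph) (k : ℕ) : Set where
  field
    cycle : Fin k → HamiltonianCycle G

  CycleArc : Fin k → Rel (V G) 0ℓ
  CycleArc i = Arc (proj₁ (cycle i))

  field
    disjoint : ∀ {i j} → i ≢ j → ∀ {x y} → ¬ (CycleArc i x y × CycleArc j x y)
    covers   : ∀ {x y} → G [ x ⟶ y ] → ∃[ i ] CycleArc i x y

HamiltonianDecomposable : Digraph → Set
HamiltonianDecomposable G = ∃[ k ] (1 ≤ k × HamiltonianDecomposition G k)

Even Odd : ℕ → Set
Even n = 2 ∣ n
Odd  n = ¬ Even n

{-# OPTIONS --safe #-}

-- Let H have order m and split into k directed hamiltonian cycles σ_a; since H is
-- neither a directed cycle nor complete, 2 ≤ k ≤ m - 2. Fix a vertex e of H and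
-- call j pure unless j = σ_a e for some a. Let C be a hamiltonian cycle of G.
--
-- For each a, one cycle of G ≀ H follows σ_a in a layer until it reaches e, and
-- from there moves to σ_a e in the next layer of C. This leaves, in every layer,
-- only the arcs from e to the impure vertices, and between consecutive layers all
-- arcs except those from e to the impure vertices. The rest is covered by m
-- further cycles, one for each vertex j. They are given by permutations between
-- consecutive layers that form a Latin square and send e to j if j is impure; an
-- impure cycle uses the arc from e to j inside the layer instead of the one to
-- the next layer. In effect it sees the contraction of these permutations, with e
-- removed.
--
-- The permutations x ↦ j ∗ x and its inverse alternate, where ∗ is a Latin square
-- with j ∗ e = j and j ∗ j = e, so as the number of layers is even they cancel,
-- contracted or not. Before the first one a fixed permutation θ is applied which
-- fixes e and is a cycle on the other vertices: this makes the impure cycles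
-- hamiltonian. For pure j a transposition (e w) is applied after the last one,
-- and (e w) θ is a cycle on all vertices. The rows remain a Latin square if the
-- set of pure vertices is invariant under j ↦ j ∗ w. For the other hamiltonian
-- cycles of G the same construction works with all j regarded as pure.
--
-- It remains to find a Latin square of order m in which two columns agree, as
-- sets, on a given set of m - k rows. Colour the edges of an m-cycle properly with
-- three colours such that exactly two edges are blue and these separate the cycle
-- into paths with k and m - k vertices. The colour classes are involutions which
-- replace three columns of the addition table of ℤ/m, and those of the colours
-- other than blue preserve both paths.

module Submission where

open import Defs
open import Data.Bool.Base using (Bool; true; false; not; if_then_else_)
open import Data.Bool.Properties using (not-injective; not-involutive)
open import Data.Fin.Base using (Fin; zero; suc; toℕ; fromℕ<; inject≤; splitAt; join; _↑ˡ_; _↑ʳ_)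
open import Data.Fin.Properties as Fin using (toℕ-fromℕ<; toℕ-injective; toℕ<n)
open import Data.Fin.Permutation using (↔⇒≡)
open import Data.Nat.Base
  using (ℕ; zero; suc; pred; _+_; _*_; _∸_; _≤_; _<_; z≤n; s≤s; NonZero; >-nonZero)
open import Data.Nat.Divisibility using (divides)
open import Data.Nat.DivMod
  using (_mod_; _%_; _/_; m≡m%n+[m/n]*n; m%n<n; m<n⇒m%n≡m; %-distribˡ-+; m%n%n≡m%n; [m+n]%n≡m%n; n%n≡0)
open import Data.Nat.Induction using (<-rec)
open import Data.Nat.Properties as ℕ using (anyUpTo?)
open import Data.Product.Base using (Σ-syntax; ∃-syntax; _×_; _,_; proj₁; proj₂)
open import Data.Product.Function.NonDependent.Propositional using (_×-↔_)
open import Data.Sum.Base as Sum using (_⊎_; inj₁; inj₂)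
open import Data.Sum.Function.Propositional using (_⊎-↔_)
open import Data.Unit.Base using (⊤; tt)
open import Function.Base using (_∘_; id)
open import Function.Bundles using (_↔_; _⇔_; Inverse; Injection; mk⇔; mk⤖; mk↔ₛ′; Equivalence)
open import Function.Construct.Composition using (_↔-∘_)
open import Function.Properties.Inverse using (↔-refl; ↔-sym; ↔⇒↣)
open import Function.Properties.Bijection using (⤖⇒↔)
open import Relation.Binary.Construct.Closure.ReflexiveTransitive using (Star; ε; _◅_; _◅◅_)
open import Relation.Binary.Definitions using (DecidableEquality; tri<; tri≈; tri>)
open import Relation.Binary.PropositionalEquality
open import Relation.Nullary.Decidable.Core using (Dec; yes; no; decidable-stable; from-yes; ¬?; _→-dec_; _⊎-dec_)
open import Relation.Nullary.Negation.Core using (¬_; contradiction)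

open Digraph using (V; order)
open SpanningCycle using (Arc)

private
  variable
    A B : Set

↔-injective : (e : A ↔ B) → ∀ {x y} → Inverse.to e x ≡ Inverse.to e y → x ≡ y
↔-injective e = Injection.injective (↔⇒↣ e)

-- Cyclic permutations and spanning cycles

Reach : (A → A) → A → A → Set
Reach f = Star (λ x y → f x ≡ y)

infixl 5 _▻ʳ_
_▻ʳ_ : {f : A → A} {x y z : A} → Reach f x y → f y ≡ z → Reach f x z
p ▻ʳ eq = p ◅◅ (eq ◅ ε)

-- The path starts at `f x` and not at `x`, so that reaching `x` itself takes at least one step and
-- closes the cycle; injectivity of `f` need not be assumed.
IsCycle : (A → A) → Set
IsCycle f = ∃[ x ] (∀ y → Reach f (f x) y)

iterate : (A → A) → ℕ → A → A
iterate f zero    x = x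
iterate f (suc n) x = f (iterate f n x)

iterate-+ : (f : A → A) (m n : ℕ) (x : A) → iterate f (m + n) x ≡ iterate f m (iterate f n x)
iterate-+ f zero    n x = refl
iterate-+ f (suc m) n x = cong f (iterate-+ f m n x)

iterate-period : (f : A → A) (n : ℕ) {t : ℕ} {x : A} → iterate f t x ≡ x → iterate f (n * t) x ≡ x
iterate-period f zero    eq = refl
iterate-period f (suc n) {t} {x} eq =
  trans (iterate-+ f t (n * t) x) (trans (cong (iterate f t) (iterate-period f n eq)) eq)

iterate-% : (f : A → A) (n : ℕ) {t : ℕ} .{{_ : NonZero t}} {x : A} →
            iterate f t x ≡ x → iterate f (n % t) x ≡ iterate f n x
iterate-% f n {t} {x} eq = sym (begin
  iterate f n x                                   ≡⟨ cong (λ k → iterate f k x) (m≡m%n+[m/n]*n n t) ⟩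
  iterate f (n % t + n / t * t) x                 ≡⟨ iterate-+ f (n % t) (n / t * t) x ⟩
  iterate f (n % t) (iterate f (n / t * t) x)     ≡⟨ cong (iterate f (n % t)) (iterate-period f (n / t) eq) ⟩
  iterate f (n % t) x                             ∎)
  where open ≡-Reasoning

reach⇒iterate : {f : A → A} {x y : A} → Reach f x y → ∃[ n ] iterate f n x ≡ y
reach⇒iterate ε = 0 , refl
reach⇒iterate {f = f} {x} (refl ◅ p) with n , eq ← reach⇒iterate p =
  n + 1 , trans (iterate-+ f n 1 x) eq

toℕ-mod : ∀ a n .{{_ : NonZero n}} → toℕ (a mod n) ≡ a % n
toℕ-mod a n = toℕ-fromℕ< (m%n<n a n)

least : {P : ℕ → Set} → (∀ n → Dec (P n)) → ∀ n → P n → ∃[ l ] (P l × (∀ {i} → i < l → ¬ P i))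
least {P} P? = <-rec _ step
  where
  step : ∀ n → (∀ {i} → i < n → P i → ∃[ l ] (P l × (∀ {i} → i < l → ¬ P i))) →
         P n → ∃[ l ] (P l × (∀ {i} → i < l → ¬ P i))
  step n rec p with anyUpTo? P? n
  ... | yes (i , i<n , q) = rec i<n q
  ... | no none           = n , p , λ i<n q → none (_ , i<n , q)

module _ (_≟_ : DecidableEquality A) (f : A → A) (moves : ∀ {x} → f x ≢ x) where

  spanningCycle : IsCycle f → Σ[ C ∈ SpanningCycle A ] (∀ {x y} → Arc C x y ⇔ f x ≡ y)
  spanningCycle (x , reach)
    with n , eq ← reach⇒iterate (reach x)
    -- The search runs over `suc n`, which excludes the trivial period 0; `suc t` is the least
    -- positive period of `x`.
    with t , period , minimal ← least (λ n → iterate f (suc n) x ≟ x) n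
           (trans (cong (λ k → iterate f k x) (ℕ.+-comm 1 n)) (trans (iterate-+ f n 1 x) eq))
    = record { length = L ; 2≤length = 2≤period t period ; vertices = vertices } , mk⇔ to from
    where
    L = suc t

    at : Fin L → A
    at i = iterate f (toℕ i) x

    at-mod : ∀ n → at (n mod L) ≡ iterate f n x
    at-mod n = trans (cong (λ k → iterate f k x) (toℕ-mod n L)) (iterate-% f n period)

    2≤period : ∀ t → iterate f (suc t) x ≡ x → 2 ≤ suc t
    2≤period zero    eq = contradiction eq moves
    2≤period (suc t) eq = s≤s (s≤s z≤n)

    -- Another `L - j` steps bring the later of the two back to `x`, so `x` would return after fewer
    -- than `L` steps.
    no-repeat : ∀ {i j} → i < j → j < L → iterate f i x ≢ iterate f j x
    no-repeat {i} {j} i<j j<L eq = minimal {r + i} r+i<t (begin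
      iterate f (suc (r + i)) x         ≡⟨ iterate-+ f (suc r) i x ⟩
      iterate f (suc r) (iterate f i x) ≡⟨ cong (iterate f (suc r)) eq ⟩
      iterate f (suc r) (iterate f j x) ≡⟨ iterate-+ f (suc r) j x ⟨
      iterate f (suc r + j) x           ≡⟨ cong (λ k → iterate f (suc k) x) (ℕ.m∸n+n≡m (ℕ.≤-pred j<L)) ⟩
      iterate f L x                     ≡⟨ period ⟩
      x                                 ∎)
      where
      open ≡-Reasoning
      r = t ∸ j
      r+i<t : r + i < t
      r+i<t = subst (r + i <_) (ℕ.m∸n+n≡m (ℕ.≤-pred j<L)) (ℕ.+-monoʳ-< r i<j)

    injective : ∀ {i j} → at i ≡ at j → i ≡ j
    injective {i} {j} eq with ℕ.<-cmp (toℕ i) (toℕ j)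
    ... | tri< i<j _ _ = contradiction eq (no-repeat i<j (toℕ<n j))
    ... | tri≈ _ i≡j _ = toℕ-injective i≡j
    ... | tri> _ _ j<i = contradiction (sym eq) (no-repeat j<i (toℕ<n i))

    surjective : ∀ y → ∃[ i ] (∀ {j} → j ≡ i → at j ≡ y)
    surjective y with n , eq ← reach⇒iterate (reach y) =
      suc n mod L , λ { refl → trans (at-mod (suc n)) (trans (shift n) eq) }
      where
      shift : ∀ n → iterate f (suc n) x ≡ iterate f n (f x)
      shift zero    = refl
      shift (suc n) = cong f (shift n)

    vertices : Fin L ↔ A
    vertices = ⤖⇒↔ (mk⤖ (injective , surjective))

    at-next : ∀ i → at (next i) ≡ f (at i)
    at-next i = at-mod (suc (toℕ i))

    to : ∀ {a b} → ∃[ i ] (at i ≡ a × at (next i) ≡ b) → f a ≡ b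
    to (i , refl , refl) = sym (at-next i)

    from : ∀ {a b} → f a ≡ b → ∃[ i ] (at i ≡ a × at (next i) ≡ b)
    from {a} refl with i , eq ← surjective a =
      i , eq refl , trans (at-next i) (cong f (eq refl))

toℕ-next : ∀ {n} .{{_ : NonZero n}} (i : Fin n) → toℕ (next i) ≡ suc (toℕ i) % n
toℕ-next {suc n} i = toℕ-mod (suc (toℕ i)) (suc n)

suc-% : ∀ a n .{{_ : NonZero n}} → suc (a % n) % n ≡ suc a % n
suc-% a n = begin
  (1 + a % n) % n             ≡⟨ %-distribˡ-+ 1 (a % n) n ⟩
  (1 % n + a % n % n) % n     ≡⟨ cong (λ z → (1 % n + z) % n) (m%n%n≡m%n a n) ⟩
  (1 % n + a % n) % n         ≡⟨ %-distribˡ-+ 1 a n ⟨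
  (1 + a) % n                 ∎
  where open ≡-Reasoning

next-mod : ∀ a {n} .{{_ : NonZero n}} → next (a mod n) ≡ suc a mod n
next-mod a {n} = toℕ-injective (begin
  toℕ (next (a mod n))      ≡⟨ toℕ-next (a mod n) ⟩
  suc (toℕ (a mod n)) % n   ≡⟨ cong (λ z → suc z % n) (toℕ-mod a n) ⟩
  suc (a % n) % n           ≡⟨ suc-% a n ⟩
  suc a % n                 ≡⟨ toℕ-mod (suc a) n ⟨
  toℕ (suc a mod n)         ∎)
  where open ≡-Reasoning

mod-cong : ∀ {a b} n .{{_ : NonZero n}} → a % n ≡ b % n → a mod n ≡ b mod n
mod-cong {a} {b} n eq = toℕ-injective (trans (toℕ-mod a n) (trans eq (sym (toℕ-mod b n))))

module Successor (C : SpanningCycle A) where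
  open SpanningCycle C using (length; 2≤length; vertices; vertex)

  instance
    nonZero : NonZero length
    nonZero = >-nonZero (ℕ.≤-trans (s≤s z≤n) 2≤length)

  index : A → Fin length
  index = Inverse.from vertices

  successor : A → A
  successor x = vertex (next (index x))

  arc⇒successor : ∀ {x y} → Arc C x y → successor x ≡ y
  arc⇒successor (i , refl , refl) = cong (vertex ∘ next) (Inverse.strictlyInverseʳ vertices i)

  successor-arc : ∀ x → Arc C x (successor x)
  successor-arc x = index x , Inverse.strictlyInverseˡ vertices x , refl

  at : ℕ → A
  at t = vertex (t mod length)

  position : A → ℕ
  position x = toℕ (index x)

  position<length : ∀ x → position x < length
  position<length x = toℕ<n (index x)

  position-at : ∀ {t} → t < length → position (at t) ≡ t
  position-at {t} t<l = trans (cong toℕ (Inverse.strictlyInverseʳ vertices (t mod length)))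
                              (trans (toℕ-mod t length) (m<n⇒m%n≡m t<l))

  at-position : ∀ x → at (position x) ≡ x
  at-position x = trans (cong vertex (toℕ-injective
    (trans (toℕ-mod (position x) length) (m<n⇒m%n≡m (position<length x)))))
    (Inverse.strictlyInverseˡ vertices x)

  at-+length : ∀ t → at (t + length) ≡ at t
  at-+length t = cong vertex (mod-cong length ([m+n]%n≡m%n t length))

  successor-at : ∀ t → successor (at t) ≡ at (suc t)
  successor-at t = trans (cong (vertex ∘ next) (Inverse.strictlyInverseʳ vertices (t mod length)))
                         (cong vertex (next-mod t))

  at-length : at length ≡ at 0
  at-length = at-+length 0

  predecessor-at : ∀ x → ∃[ t ] (t < length × at (suc t) ≡ x)
  predecessor-at x with position x in eq
  ... | zero  = pred length , ℕ.≤-reflexive (ℕ.suc-pred length) ,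
                trans (cong at (ℕ.suc-pred length))
                  (trans at-length (trans (cong at (sym eq)) (at-position x)))
  ... | suc t = t , ℕ.<-trans (ℕ.n<1+n t) (subst (_< length) eq (position<length x)) ,
                trans (cong at (sym eq)) (at-position x)

  reach-at : ∀ s t → Reach successor (at t) (at (s + t))
  reach-at zero    t = ε
  reach-at (suc s) t = reach-at s t ▻ʳ successor-at (s + t)

  successor-transitive : ∀ x y → Reach successor x y
  successor-transitive x y = subst₂ (Reach successor) (at-position x) end (reach-at s (position x))
    where
    -- The path first completes the turn and then goes on to `y`, which avoids comparing the two
    -- positions.
    s = position y + (length ∸ position x)
    end : at (s + position x) ≡ y
    end = trans (cong at (trans (ℕ.+-assoc (position y) (length ∸ position x) (position x))
                  (cong (position y +_) (ℕ.m∸n+n≡m (ℕ.<⇒≤ (position<length x))))))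
                (trans (at-+length (position y)) (at-position y))

-- Decompositions as families of permutations

module Successors {G : Digraph} {k : ℕ} (D : HamiltonianDecomposition G k) where
  open HamiltonianDecomposition D
  open Digraph G using (_⟶_)

  module Cycle (i : Fin k) = Successor (proj₁ (cycle i))

  σ : Fin k → V G → V G
  σ i = Cycle.successor i

  σ-arc : ∀ i x → x ⟶ σ i x
  σ-arc i x = proj₂ (cycle i) (Cycle.successor-arc i x)

  σ-moves : ∀ i {x} → σ i x ≢ x
  σ-moves i {x} eq = Digraph.loopless G (subst (x ⟶_) eq (σ-arc i x))

  σ-injective : ∀ x {i j} → σ i x ≡ σ j x → i ≡ j
  σ-injective x {i} {j} eq with i Fin.≟ j
  ... | yes i≡j = i≡j
  ... | no  i≢j = contradiction
    (Cycle.successor-arc i x , subst (Arc (proj₁ (cycle j)) x) (sym eq) (Cycle.successor-arc j x))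
    (disjoint i≢j)

  σ-covers : ∀ {x y} → x ⟶ y → ∃[ i ] σ i x ≡ y
  σ-covers x⟶y with i , arc ← covers x⟶y = i , Cycle.arc⇒successor i arc

-- At each vertex `x` the map from `i` to `f i x` is a bijection onto the out-neighbours of `x`: its
-- injectivity is arc-disjointness, its surjectivity is covering.
decomposition : (G : Digraph) {I : Set} {k : ℕ} → Fin k ↔ I →
                (f : I → V G → V G) →
                (∀ i → IsCycle (f i)) →
                (∀ i x → G [ x ⟶ f i x ]) →
                (∀ x {i j} → f i x ≡ f j x → i ≡ j) →
                (∀ {x y} → G [ x ⟶ y ] → ∃[ i ] f i x ≡ y) →
                HamiltonianDecomposition G k
decomposition G {I} {k} I↔ f cyclic arc injective covers = record
  { cycle    = λ i → proj₁ (spanning i) ,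
                     λ {x} a → subst (G [ x ⟶_]) (to (proj₂ (spanning i)) a) (arc (I↔.to i) x)
  ; disjoint = λ i≢j (a , b) → i≢j (↔-injective I↔ (injective _
                     (trans (to (proj₂ (spanning _)) a) (sym (to (proj₂ (spanning _)) b)))))
  ; covers   = cover
  }
  where
  module I↔ = Inverse I↔
  open Equivalence using (to; from)

  spanning : ∀ i → Σ[ C ∈ SpanningCycle (V G) ] (∀ {x y} → Arc C x y ⇔ f (I↔.to i) x ≡ y)
  spanning i = spanningCycle (Digraph._≟_ G) (f (I↔.to i))
    (λ {x} eq → Digraph.loopless G (subst (G [ x ⟶_]) eq (arc (I↔.to i) x)))
    (cyclic (I↔.to i))

  cover : ∀ {x y} → G [ x ⟶ y ] → ∃[ i ] Arc (proj₁ (spanning i)) x y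
  cover {x} {y} x⟶y with i , eq ← covers x⟶y =
    I↔.from i , from (proj₂ (spanning (I↔.from i)))
                     (trans (cong (λ j → f j x) (I↔.strictlyInverseˡ i)) eq)

-- Bounds on the number of cycles

1<#cycles : ∀ {H k} → HamiltonianDecomposition H k → 1 ≤ k → ¬ IsDirectedCycle H → 1 < k
1<#cycles {H} {suc zero} D _ ¬cycle =
  contradiction (proj₁ (cycle zero) , λ {x} {y} → mk⇔ cover (proj₂ (cycle zero) {x} {y})) ¬cycle
  where
  open HamiltonianDecomposition D
  cover : ∀ {x y} → H [ x ⟶ y ] → CycleArc zero x y
  cover x⟶y with zero , arc ← covers x⟶y = arc
1<#cycles {k = suc (suc k)} _ _ _ = s≤s (s≤s z≤n)

module Fan {H : Digraph} {k : ℕ} (D : HamiltonianDecomposition H k) where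
  open Successors D
  open Digraph H using (_⟶_; _⟶?_; enumeration)

  -- The closed out-neighbourhood of `x`. When `x` is the special vertex, index zero will give the
  -- unit of the Latin square and the other indices the impure vertices.
  fan : V H → Fin (suc k) → V H
  fan x zero    = x
  fan x (suc a) = σ a x

  fan-injective : ∀ x {i j} → fan x i ≡ fan x j → i ≡ j
  fan-injective x {zero}  {zero}  eq = refl
  fan-injective x {zero}  {suc j} eq = contradiction (sym eq) (σ-moves j)
  fan-injective x {suc i} {zero}  eq = contradiction eq (σ-moves i)
  fan-injective x {suc i} {suc j} eq = cong suc (σ-injective x eq)

  module _ {x y : V H} (x≢y : x ≢ y) (¬arc : ¬ (x ⟶ y)) where
    extended : Fin (suc (suc k)) → V H
    extended zero    = y
    extended (suc i) = fan x i

    y∉fan : ∀ i → fan x i ≢ y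
    y∉fan zero    eq   = x≢y eq
    y∉fan (suc a) refl = ¬arc (σ-arc a x)

    extended-injective : ∀ {i j} → extended i ≡ extended j → i ≡ j
    extended-injective {zero}  {zero}  eq = refl
    extended-injective {zero}  {suc j} eq = contradiction (sym eq) (y∉fan j)
    extended-injective {suc i} {zero}  eq = contradiction eq (y∉fan i)
    extended-injective {suc i} {suc j} eq = cong suc (fan-injective x eq)

    -- The closed out-neighbourhood of `x` and the vertex `y` outside it make `k + 2` distinct
    -- vertices.
    non-arc⇒#cycles<order : suc (suc k) ≤ order H
    non-arc⇒#cycles<order = Fin.injective⇒≤
      {f = Inverse.from enumeration ∘ extended}
      (extended-injective ∘ ↔-injective (↔-sym enumeration))

  #cycles+2≤order : ¬ IsCompleteSymmetric H → suc (suc k) ≤ order H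
  #cycles+2≤order ¬complete with suc (suc k) ℕ.≤? order H
  ... | yes k+2≤m = k+2≤m
  ... | no  k+2≰m = contradiction
    (λ {x} {y} x≢y → decidable-stable (x ⟶? y) (λ ¬arc → k+2≰m (non-arc⇒#cycles<order x≢y ¬arc)))
    ¬complete

-- Transpositions

module Swap (_≟_ : DecidableEquality A) where
  swap : A → A → A → A
  swap a b x with x ≟ a | x ≟ b
  ... | yes _ | _     = b
  ... | no  _ | yes _ = a
  ... | no  _ | no  _ = x

  swapˡ : ∀ a b → swap a b a ≡ b
  swapˡ a b with a ≟ a | a ≟ b
  ... | yes _  | _ = refl
  ... | no a≢a | _ = contradiction refl a≢a

  swapʳ : ∀ a b → swap a b b ≡ a
  swapʳ a b with b ≟ a | b ≟ b
  ... | yes b≡a | _       = b≡a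
  ... | no  _   | yes _   = refl
  ... | no  _   | no  b≢b = contradiction refl b≢b

  swap-fixes : ∀ {a b x} → x ≢ a → x ≢ b → swap a b x ≡ x
  swap-fixes {a} {b} {x} x≢a x≢b with x ≟ a | x ≟ b
  ... | yes x≡a | _       = contradiction x≡a x≢a
  ... | no  _   | yes x≡b = contradiction x≡b x≢b
  ... | no  _   | no  _   = refl

  swap-involutive : ∀ a b x → swap a b (swap a b x) ≡ x
  swap-involutive a b x with x ≟ a in p | x ≟ b in q
  ... | yes x≡a | _       = trans (swapʳ a b) (sym x≡a)
  ... | no  _   | yes x≡b = trans (swapˡ a b) (sym x≡b)
  ... | no  x≢a | no  x≢b = swap-fixes x≢a x≢b

  -- The values at 0, 1, … are corrected one after the other by transpositions.
  extend-injection : ∀ {k m} (k≤m : k ≤ m) (f : Fin k → A) → (∀ {i j} → f i ≡ f j → i ≡ j) →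
                     Fin m ↔ A → Σ[ φ ∈ Fin m ↔ A ] (∀ i → Inverse.to φ (inject≤ i k≤m) ≡ f i)
  extend-injection {k} {m} k≤m f f-injective φ₀ =
    proj₁ (go k ℕ.≤-refl) , λ i → proj₂ (go k ℕ.≤-refl) i (toℕ<n i)
    where
    Agrees : ℕ → Fin m ↔ A → Set
    Agrees t φ = ∀ i → toℕ i < t → Inverse.to φ (inject≤ i k≤m) ≡ f i

    go : ∀ t → t ≤ k → Σ[ φ ∈ Fin m ↔ A ] Agrees t φ
    go zero    _   = φ₀ , λ _ ()
    go (suc t) t<k with φ , agrees ← go t (ℕ.<⇒≤ t<k) = φ′ , agrees′
      where
      module φ = Inverse φ
      new = fromℕ< t<k
      a = φ.to (inject≤ new k≤m)
      b = f new

      φ′ : Fin m ↔ A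
      φ′ = mk↔ₛ′ (swap a b ∘ φ.to) (φ.from ∘ swap a b)
        (λ x → trans (cong (swap a b) (φ.strictlyInverseˡ _)) (swap-involutive a b x))
        (λ i → trans (cong φ.from (swap-involutive a b _)) (φ.strictlyInverseʳ i))

      agrees′ : Agrees (suc t) φ′
      agrees′ i i<1+t with i Fin.≟ new
      ... | yes refl = swapˡ a b
      ... | no  i≢new = trans (swap-fixes ≢a ≢b) agree
        where
        i<t : toℕ i < t
        i<t = ℕ.≤∧≢⇒< (ℕ.≤-pred i<1+t) (λ eq → i≢new (toℕ-injective (trans eq (sym (toℕ-fromℕ< t<k)))))
        agree = agrees i i<t
        ≢a : φ.to (inject≤ i k≤m) ≢ a
        ≢a eq = i≢new (Fin.inject≤-injective k≤m k≤m i new (↔-injective φ eq))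
        ≢b : φ.to (inject≤ i k≤m) ≢ b
        ≢b eq = i≢new (f-injective (trans (sym agree) eq))

-- Latin squares

-- Any two of row, column and symbol determine the third. The three types are kept apart because the
-- columns used below are indexed by colours and offsets.
record LatinSquare (R C S : Set) : Set where
  field
    entry        : R → C → S
    column       : R → S → C
    row          : C → S → R
    entry-column : ∀ r s → entry r (column r s) ≡ s
    column-entry : ∀ r c → column r (entry r c) ≡ c
    entry-row    : ∀ c s → entry (row c s) c ≡ s
    row-entry    : ∀ r c → row c (entry r c) ≡ r

-- A quasigroup with right unit e in which every element squares to e; the
-- subtraction of a group is an example.
record Subtraction (A : Set) (e : A) : Set where
  infixl 7 _∗_ _\\_ _//_
  field
    _∗_ _\\_ _//_ : A → A → A
    leftDividesˡ  : ∀ x y → x ∗ (x \\ y) ≡ y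
    leftDividesʳ  : ∀ x y → x \\ (x ∗ y) ≡ y
    rightDividesˡ : ∀ x y → (y // x) ∗ x ≡ y
    rightDividesʳ : ∀ x y → (y ∗ x) // x ≡ y
    identityʳ     : ∀ x → x ∗ e ≡ x
    unipotent     : ∀ x → x ∗ x ≡ e

  ∗-cancelˡ : ∀ x {y z} → x ∗ y ≡ x ∗ z → y ≡ z
  ∗-cancelˡ x {y} {z} eq = trans (sym (leftDividesʳ x y)) (trans (cong (x \\_) eq) (leftDividesʳ x z))

  ∗-cancelʳ : ∀ x {y z} → y ∗ x ≡ z ∗ x → y ≡ z
  ∗-cancelʳ x {y} {z} eq = trans (sym (rightDividesʳ x y)) (trans (cong (_// x) eq) (rightDividesʳ x z))

  \\-unit : ∀ x → x \\ e ≡ x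
  \\-unit x = trans (cong (x \\_) (sym (unipotent x))) (leftDividesʳ x x)

  \\-self : ∀ x → x \\ x ≡ e
  \\-self x = trans (cong (x \\_) (sym (identityʳ x))) (leftDividesʳ x e)

-- An isotopy: rows are renamed after their symbol in column `c₀`, which makes that column the right
-- unit, and columns after the row in which they contain `s₀`, which puts `s₀` on the diagonal.
module Normalize {R C S : Set} (L : LatinSquare R C S) (φ : S ↔ A) (c₀ : C) (s₀ : S)
                 {e : A} (to-s₀ : Inverse.to φ s₀ ≡ e) where
  open LatinSquare L
  open Inverse φ using (to; from; strictlyInverseˡ; strictlyInverseʳ)

  rowOf : A → R
  rowOf x = row c₀ (from x)

  columnOf : A → C
  columnOf x = column (rowOf x) s₀

  fromColumn : C → A
  fromColumn c = to (entry (row c s₀) c₀)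

  rowOf-to-entry : ∀ r → rowOf (to (entry r c₀)) ≡ r
  rowOf-to-entry r = trans (cong (row c₀) (strictlyInverseʳ _)) (row-entry r c₀)

  to-entry-rowOf : ∀ x → to (entry (rowOf x) c₀) ≡ x
  to-entry-rowOf x = trans (cong to (entry-row c₀ (from x))) (strictlyInverseˡ x)

  columnOf-fromColumn : ∀ c → columnOf (fromColumn c) ≡ c
  columnOf-fromColumn c = begin
    column (rowOf (fromColumn c)) s₀            ≡⟨ cong (λ r → column r s₀) (rowOf-to-entry _) ⟩
    column (row c s₀) s₀                        ≡⟨ cong (column (row c s₀)) (entry-row c s₀) ⟨
    column (row c s₀) (entry (row c s₀) c)      ≡⟨ column-entry _ c ⟩
    c                                           ∎
    where open ≡-Reasoning

  row-columnOf : ∀ x → row (columnOf x) s₀ ≡ rowOf x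
  row-columnOf x = trans (cong (row (columnOf x)) (sym (entry-column (rowOf x) s₀)))
                         (row-entry (rowOf x) (columnOf x))

  fromColumn-columnOf : ∀ x → fromColumn (columnOf x) ≡ x
  fromColumn-columnOf x = trans (cong (λ r → to (entry r c₀)) (row-columnOf x)) (to-entry-rowOf x)

  from-unit : from e ≡ s₀
  from-unit = trans (cong from (sym to-s₀)) (strictlyInverseʳ s₀)

  columnOf-unit : columnOf e ≡ c₀
  columnOf-unit = begin
    column (row c₀ (from e)) s₀               ≡⟨ cong (λ s → column (row c₀ s) s₀) from-unit ⟩
    column (row c₀ s₀) s₀                     ≡⟨ cong (column (row c₀ s₀)) (entry-row c₀ s₀) ⟨
    column (row c₀ s₀) (entry (row c₀ s₀) c₀) ≡⟨ column-entry _ c₀ ⟩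
    c₀                                        ∎
    where open ≡-Reasoning

  subtraction : Subtraction A e
  subtraction = record
    { _∗_  = λ j x → to (entry (rowOf j) (columnOf x))
    ; _\\_ = λ j y → fromColumn (column (rowOf j) (from y))
    ; _//_ = λ y x → to (entry (row (columnOf x) (from y)) c₀)
    ; leftDividesˡ = λ j y → trans (cong (to ∘ entry (rowOf j)) (columnOf-fromColumn _))
        (trans (cong to (entry-column (rowOf j) (from y))) (strictlyInverseˡ y))
    ; leftDividesʳ = λ j x → trans (cong (fromColumn ∘ column (rowOf j)) (strictlyInverseʳ _))
        (trans (cong fromColumn (column-entry (rowOf j) (columnOf x))) (fromColumn-columnOf x))
    ; rightDividesˡ = λ x y → trans (cong (λ r → to (entry r (columnOf x))) (rowOf-to-entry _))
        (trans (cong to (entry-row (columnOf x) (from y))) (strictlyInverseˡ y))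
    ; rightDividesʳ = λ x j → trans (cong (λ s → to (entry (row (columnOf x) s) c₀)) (strictlyInverseʳ _))
        (trans (cong (λ r → to (entry r c₀)) (row-entry (rowOf j) (columnOf x))) (to-entry-rowOf j))
    ; identityʳ = λ x → trans (cong (to ∘ entry (rowOf x)) columnOf-unit) (to-entry-rowOf x)
    ; unipotent = λ x → trans (cong to (entry-column (rowOf x) s₀)) to-s₀
    }

  open Subtraction subtraction

  -- In terms of symbols, right translation by the name of `c` passes from column `c₀` to column `c`
  -- within a row.
  from-∗-fromColumn : ∀ j c → from (j ∗ fromColumn c) ≡ entry (rowOf j) c
  from-∗-fromColumn j c = trans (strictlyInverseʳ _) (cong (entry (rowOf j)) (columnOf-fromColumn c))

-- Addition modulo n and coloured cycles

mod-+ : ∀ a b n .{{_ : NonZero n}} → (toℕ (a mod n) + b) mod n ≡ (a + b) mod n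
mod-+ a b n = mod-cong n (begin
  (toℕ (a mod n) + b) % n      ≡⟨ cong (λ z → (z + b) % n) (toℕ-mod a n) ⟩
  (a % n + b) % n              ≡⟨ %-distribˡ-+ (a % n) b n ⟩
  (a % n % n + b % n) % n      ≡⟨ cong (λ z → (z + b % n) % n) (m%n%n≡m%n a n) ⟩
  (a % n + b % n) % n          ≡⟨ %-distribˡ-+ a b n ⟨
  (a + b) % n                  ∎)
  where open ≡-Reasoning

mod-toℕ : ∀ {n} .{{_ : NonZero n}} (i : Fin n) → toℕ i mod n ≡ i
mod-toℕ {n} i = toℕ-injective (trans (toℕ-mod (toℕ i) n) (m<n⇒m%n≡m (toℕ<n i)))

module _ {n : ℕ} .{{_ : NonZero n}} where
  infixl 6 _⊕_ _⊖_

  _⊕_ _⊖_ : Fin n → Fin n → Fin n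
  i ⊕ j = (toℕ i + toℕ j) mod n
  i ⊖ j = (toℕ i + (n ∸ toℕ j)) mod n

  ⊕-comm : ∀ i j → i ⊕ j ≡ j ⊕ i
  ⊕-comm i j = cong (_mod n) (ℕ.+-comm (toℕ i) (toℕ j))

  private
    full-turn : ∀ {a b} i → a + b ≡ n → (toℕ i + a + b) mod n ≡ i
    full-turn {a} {b} i a+b≡n = trans
      (mod-cong n (trans (cong (_% n) (trans (ℕ.+-assoc (toℕ i) a b) (cong (toℕ i +_) a+b≡n)))
                         ([m+n]%n≡m%n (toℕ i) n)))
      (mod-toℕ i)

  ⊖-⊕ : ∀ i j → i ⊖ j ⊕ j ≡ i
  ⊖-⊕ i j = trans (mod-+ _ (toℕ j) n) (full-turn i (ℕ.m∸n+n≡m (ℕ.<⇒≤ (toℕ<n j))))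

  ⊕-⊖ : ∀ i j → i ⊕ j ⊖ j ≡ i
  ⊕-⊖ i j = trans (mod-+ _ (n ∸ toℕ j) n) (full-turn i (ℕ.m+[n∸m]≡n (ℕ.<⇒≤ (toℕ<n j))))

-- The three colours add up to 0 modulo 3; the multiple 6 is large enough to avoid truncated
-- subtraction.
third : Fin 3 → Fin 3 → Fin 3
third p q = (6 ∸ (toℕ p + toℕ q)) mod 3

third≢ˡ : ∀ p q → p ≢ q → third p q ≢ p
third≢ˡ = from-yes (Fin.all? λ p → Fin.all? λ q → ¬? (p Fin.≟ q) →-dec ¬? (third p q Fin.≟ p))

third≢ʳ : ∀ p q → p ≢ q → third p q ≢ q
third≢ʳ = from-yes (Fin.all? λ p → Fin.all? λ q → ¬? (p Fin.≟ q) →-dec ¬? (third p q Fin.≟ q))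

third-unique : ∀ p q x → p ≢ q → x ≢ p → x ≢ q → third p q ≡ x
third-unique = from-yes (Fin.all? λ p → Fin.all? λ q → Fin.all? λ x →
  ¬? (p Fin.≟ q) →-dec ¬? (x Fin.≟ p) →-dec ¬? (x Fin.≟ q) →-dec (third p q Fin.≟ x))

-- In the addition table of ℤ/m the columns 0, 1 and -1 contain, in row r, the
-- vertices r, r + 1 and r - 1, that is r and its neighbours on an m-cycle. They
-- are replaced by three involutions, one for each colour of a proper edge
-- colouring: r goes to its neighbour along the edge of that colour, or else is
-- fixed. Here w i is the colour of the edge from i to i + 1. An offset is one
-- more than the difference of an entry and its row.
module Coloured {n : ℕ} (w : Fin (3 + n) → Fin 3) (proper : ∀ i → w i ≢ w (next i)) where
  private
    m = 3 + n
    one : Fin m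
    one = suc zero

  prev : Fin m → Fin m
  prev i = i ⊖ one

  next-prev : ∀ i → next (prev i) ≡ i
  next-prev i = trans (⊕-comm one (prev i)) (⊖-⊕ i one)

  prev-next : ∀ i → prev (next i) ≡ i
  prev-next i = trans (cong prev (⊕-comm one i)) (⊕-⊖ i one)

  proper′ : ∀ i → w i ≢ w (prev i)
  proper′ i eq = proper (prev i) (trans (sym eq) (cong w (sym (next-prev i))))

  slot : Fin m → Fin 3 → Fin 3
  slot r x with x Fin.≟ w r | x Fin.≟ w (prev r)
  ... | yes _ | _     = suc (suc zero)
  ... | no  _ | yes _ = zero
  ... | no  _ | no  _ = suc zero

  colour : Fin m → Fin 3 → Fin 3
  colour r zero             = w (prev r)
  colour r (suc zero)       = third (w r) (w (prev r))
  colour r (suc (suc zero)) = w r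

  -- The two edges at `r` have different colours, so in each row the three colours take the offsets
  -- 0, 1 and 2 once each.
  colour-slot : ∀ r x → colour r (slot r x) ≡ x
  colour-slot r x with x Fin.≟ w r | x Fin.≟ w (prev r)
  ... | yes p | _     = sym p
  ... | no  _ | yes q = sym q
  ... | no  p | no  q = third-unique _ _ x (proper′ r) p q

  slot-next : ∀ {r x} → x ≡ w r → slot r x ≡ suc (suc zero)
  slot-next {r} {x} x≡w with x Fin.≟ w r
  ... | yes _   = refl
  ... | no  x≢w = contradiction x≡w x≢w

  slot-prev : ∀ {r x} → x ≡ w (prev r) → slot r x ≡ zero
  slot-prev {r} {x} x≡w′ with x Fin.≟ w r | x Fin.≟ w (prev r)
  ... | yes x≡w | _        = contradiction (trans (sym x≡w) x≡w′) (proper′ r)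
  ... | no  _   | yes _    = refl
  ... | no  _   | no  x≢w′ = contradiction x≡w′ x≢w′

  slot-fixed : ∀ {r x} → x ≢ w r → x ≢ w (prev r) → slot r x ≡ suc zero
  slot-fixed {r} {x} x≢w x≢w′ with x Fin.≟ w r | x Fin.≟ w (prev r)
  ... | yes x≡w | _        = contradiction x≡w x≢w
  ... | no  _   | yes x≡w′ = contradiction x≡w′ x≢w′
  ... | no  _   | no  _    = refl

  slot-colour : ∀ r t → slot r (colour r t) ≡ t
  slot-colour r zero             = slot-prev refl
  slot-colour r (suc zero)       = slot-fixed (third≢ˡ _ _ (proper′ r)) (third≢ʳ _ _ (proper′ r))
  slot-colour r (suc (suc zero)) = slot-next refl

  Column : Set
  Column = Fin 3 ⊎ Fin n

  offset : Fin m → Column → Fin m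
  offset r c = join 3 n (Sum.map₁ (slot r) c)

  entry : Fin m → Column → Fin m
  entry r c = prev (offset r c ⊕ r)

  neighbour : Fin 3 → Fin m → Fin m
  neighbour x r = entry r (inj₁ x)

  at-slot : Fin m → Fin 3 → Fin m
  at-slot r t = prev ((t ↑ˡ n) ⊕ r)

  neighbour-next : ∀ {r x} → x ≡ w r → neighbour x r ≡ next r
  neighbour-next {r} x≡w = trans (cong (at-slot r) (slot-next x≡w))
    (trans (cong prev (sym (next-mod (suc (toℕ r))))) (prev-next (next r)))

  neighbour-prev : ∀ {r x} → x ≡ w (prev r) → neighbour x r ≡ prev r
  neighbour-prev {r} x≡w = trans (cong (at-slot r) (slot-prev x≡w)) (cong prev (mod-toℕ r))

  neighbour-fixed : ∀ {r x} → x ≢ w r → x ≢ w (prev r) → neighbour x r ≡ r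
  neighbour-fixed {r} p q = trans (cong (at-slot r) (slot-fixed p q)) (prev-next r)

  -- The edge of colour `x` taken from `r` has the same colour when seen from its other end.
  neighbour-involutive : ∀ x r → neighbour x (neighbour x r) ≡ r
  neighbour-involutive x r = by-cases (x Fin.≟ w r) (x Fin.≟ w (prev r))
    where
    by-cases : Dec (x ≡ w r) → Dec (x ≡ w (prev r)) → neighbour x (neighbour x r) ≡ r
    by-cases (yes p) _ = trans (cong (neighbour x) (neighbour-next p))
      (trans (neighbour-prev (trans p (cong w (sym (prev-next r))))) (prev-next r))
    by-cases (no _) (yes q) = trans (cong (neighbour x) (neighbour-prev q))
      (trans (neighbour-next q) (next-prev r))
    by-cases (no p) (no q) = trans (cong (neighbour x) (neighbour-fixed p q)) (neighbour-fixed p q)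

  -- Within a row, the colouring only permutes the offsets 0, 1 and 2 of the addition table. Down a
  -- column, the entries form an involution or a translation.
  latinSquare : LatinSquare (Fin m) Column (Fin m)
  latinSquare = record
    { entry        = entry
    ; column       = column
    ; row          = row
    ; entry-column = λ r s → trans (cong (λ d → prev (d ⊕ r)) (offset-column r s))
                             (trans (cong prev (⊖-⊕ (next s) r)) (prev-next s))
    ; column-entry = λ r c → trans (cong (Sum.map₁ (colour r) ∘ splitAt 3)
                                         (trans (cong (_⊖ r) (next-prev (offset r c ⊕ r))) (⊕-⊖ (offset r c) r)))
                             (trans (cong (Sum.map₁ (colour r)) (Fin.splitAt-join 3 n (Sum.map₁ (slot r) c)))
                                    (colour-slot′ r c))
    ; entry-row    = entry-row
    ; row-entry    = row-entry
    }
    where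
    column : Fin m → Fin m → Column
    column r s = Sum.map₁ (colour r) (splitAt 3 (next s ⊖ r))

    row : Column → Fin m → Fin m
    row (inj₁ x) s = neighbour x s
    row (inj₂ d) s = next s ⊖ (3 ↑ʳ d)

    slot-colour′ : ∀ r (c : Column) → Sum.map₁ (slot r) (Sum.map₁ (colour r) c) ≡ c
    slot-colour′ r (inj₁ t) = cong inj₁ (slot-colour r t)
    slot-colour′ r (inj₂ d) = refl

    colour-slot′ : ∀ r (c : Column) → Sum.map₁ (colour r) (Sum.map₁ (slot r) c) ≡ c
    colour-slot′ r (inj₁ x) = cong inj₁ (colour-slot r x)
    colour-slot′ r (inj₂ d) = refl

    offset-column : ∀ r s → offset r (column r s) ≡ next s ⊖ r
    offset-column r s = trans (cong (join 3 n) (slot-colour′ r (splitAt 3 (next s ⊖ r)))) (Fin.join-splitAt 3 n (next s ⊖ r))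

    entry-row : ∀ c s → entry (row c s) c ≡ s
    entry-row (inj₁ x) s = neighbour-involutive x s
    entry-row (inj₂ d) s = trans (cong prev (trans (⊕-comm (3 ↑ʳ d) _) (⊖-⊕ (next s) (3 ↑ʳ d)))) (prev-next s)

    row-entry : ∀ r c → row c (entry r c) ≡ r
    row-entry r (inj₁ x) = neighbour-involutive x r
    row-entry r (inj₂ d) = trans (cong (_⊖ (3 ↑ʳ d)) (trans (next-prev _) (⊕-comm (3 ↑ʳ d) r))) (⊕-⊖ r (3 ↑ʳ d))

-- An edge colouring with two blue edges

parity : ℕ → Bool
parity zero    = true
parity (suc n) = not (parity n)

hue : Bool → Fin 3
hue true  = zero
hue false = suc zero

red green blue : Fin 3
red   = hue true
green = hue false
blue  = suc (suc zero)

hue≢blue : ∀ b → hue b ≢ blue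
hue≢blue true  ()
hue≢blue false ()

hue-not : ∀ b → hue b ≢ hue (not b)
hue-not true  ()
hue-not false ()

-- The blue edges of the m-cycle 0, …, m - 1 are those from 0 and from k, so the
-- other two involutions preserve the set {0, k + 1, …, m - 1}.
module Separated {n k : ℕ} (2≤k : 2 ≤ k) (k+2≤m : 2 + k ≤ 3 + n) where
  private
    m = 3 + n

  edgeColour : ℕ → Fin 3
  edgeColour t with t ℕ.≟ 0 | t ℕ.≟ k
  ... | yes _ | _     = blue
  ... | no  _ | yes _ = blue
  ... | no  _ | no  _ = hue (parity t)

  edgeColour-k : ∀ {t} → t ≡ k → edgeColour t ≡ blue
  edgeColour-k {t} t≡k with t ℕ.≟ 0 | t ℕ.≟ k
  ... | yes _ | _       = refl
  ... | no  _ | yes _   = refl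
  ... | no  _ | no  t≢k = contradiction t≡k t≢k

  edgeColour-hue : ∀ {t} → t ≢ 0 → t ≢ k → edgeColour t ≡ hue (parity t)
  edgeColour-hue {t} t≢0 t≢k with t ℕ.≟ 0 | t ℕ.≟ k
  ... | yes t≡0 | _       = contradiction t≡0 t≢0
  ... | no  _   | yes t≡k = contradiction t≡k t≢k
  ... | no  _   | no  _   = refl

  edgeColour≢blue : ∀ {t} → t ≢ 0 → t ≢ k → edgeColour t ≢ blue
  edgeColour≢blue {t} t≢0 t≢k eq = hue≢blue (parity t) (trans (sym (edgeColour-hue t≢0 t≢k)) eq)

  -- Red and green alternate with the parity, and the two blue edges are not consecutive here
  -- because `k` is at least 2.
  edgeColour-suc : ∀ t → edgeColour t ≢ edgeColour (suc t)
  edgeColour-suc t with t ℕ.≟ 0 in p | t ℕ.≟ k in q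
  ... | yes refl | _        = ≢-sym (edgeColour≢blue (λ ()) (ℕ.<⇒≢ 2≤k))
  ... | no  _    | yes refl = ≢-sym (edgeColour≢blue (λ ()) (ℕ.>⇒≢ (ℕ.n<1+n t)))
  ... | no  t≢0  | no  t≢k  with suc t ℕ.≟ k
  ...   | yes _   = hue≢blue (parity t)
  ...   | no  _   = hue-not (parity t)

  w : Fin m → Fin 3
  w = edgeColour ∘ toℕ

  data Next (i : Fin m) : Set where
    inner : toℕ (next i) ≡ suc (toℕ i) → Next i
    wrap  : suc (toℕ i) ≡ m → toℕ (next i) ≡ 0 → Next i

  next-view : ∀ i → Next i
  next-view i with ℕ.m≤n⇒m<n∨m≡n (toℕ<n i)
  ... | inj₁ i+1<m = inner (trans (toℕ-next i) (m<n⇒m%n≡m i+1<m))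
  ... | inj₂ i+1≡m = wrap i+1≡m (trans (toℕ-next i) (trans (cong (_% m) i+1≡m) (n%n≡0 m)))

  wrap⇒k< : ∀ {i : Fin m} → suc (toℕ i) ≡ m → k < toℕ i
  wrap⇒k< i+1≡m = ℕ.≤-pred (ℕ.≤-trans k+2≤m (ℕ.≤-reflexive (sym i+1≡m)))

  proper : ∀ i → w i ≢ w (next i)
  proper i with next-view i
  ... | inner eq      = λ same → edgeColour-suc (toℕ i) (trans same (cong edgeColour eq))
  -- The last edge lies beyond `k` and is not blue, while the edge from 0 is; so the parity of `m`
  -- does not matter.
  ... | wrap i+1≡m eq = λ same → edgeColour≢blue
    (λ i≡0 → ℕ.n≮0 (subst (k <_) i≡0 k<i)) (ℕ.>⇒≢ k<i) (trans same (cong edgeColour eq))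
    where k<i = wrap⇒k< {i} i+1≡m

  open Coloured w proper public

  Pure : Fin m → Set
  Pure i = toℕ i ≡ 0 ⊎ k < toℕ i

  pure? : ∀ i → Dec (Pure i)
  pure? i = (toℕ i ℕ.≟ 0) ⊎-dec (k ℕ.<? toℕ i)

  -- The set can be left only through the edge from 0 and entered only through the edge from `k`,
  -- and both are blue.
  pure-next : ∀ {i} → w i ≢ blue → Pure i → Pure (next i)
  pure-next {i} w≢blue (inj₁ i≡0) = contradiction (cong edgeColour i≡0) w≢blue
  pure-next {i} w≢blue (inj₂ k<i) with next-view i
  ... | inner eq  = inj₂ (subst (k <_) (sym eq) (ℕ.m<n⇒m<1+n k<i))
  ... | wrap _ eq = inj₁ eq

  pure-next⁻ : ∀ {i} → w i ≢ blue → Pure (next i) → Pure i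
  pure-next⁻ {i} w≢blue p with next-view i
  ... | wrap i+1≡m _ = inj₂ (wrap⇒k< {i} i+1≡m)
  ... | inner eq with p
  ...   | inj₁ next≡0 = contradiction (trans (sym eq) next≡0) λ ()
  ...   | inj₂ k<next = inj₂ (ℕ.≤∧≢⇒< (ℕ.≤-pred (subst (k <_) eq k<next))
                                     (λ k≡i → w≢blue (edgeColour-k (sym k≡i))))

  pure-neighbour : ∀ {x} i → x ≢ blue → Pure i → Pure (neighbour x i)
  pure-neighbour {x} i x≢blue p = by-cases (x Fin.≟ w i) (x Fin.≟ w (prev i))
    where
    by-cases : Dec (x ≡ w i) → Dec (x ≡ w (prev i)) → Pure (neighbour x i)
    by-cases (yes q) _ = subst Pure (sym (neighbour-next q)) (pure-next (x≢blue ∘ trans q) p)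
    by-cases (no _) (yes q) = subst Pure (sym (neighbour-prev q))
      (pure-next⁻ (x≢blue ∘ trans q) (subst Pure (sym (next-prev i)) p))
    by-cases (no q) (no r) = subst Pure (sym (neighbour-fixed q r)) p

  pure-neighbour⁻ : ∀ {x} i → x ≢ blue → Pure (neighbour x i) → Pure i
  pure-neighbour⁻ {x} i x≢blue p =
    subst Pure (neighbour-involutive x i) (pure-neighbour (neighbour x i) x≢blue p)

  -- The row whose red entry is `i` is `neighbour red i`, so this concerns the green entry of that
  -- row. Neither move uses a blue edge.
  pure-red-green : ∀ i → Pure i → Pure (neighbour green (neighbour red i))
  pure-red-green i p =
    pure-neighbour {green} (neighbour red i) (λ ()) (pure-neighbour {red} i (λ ()) p)

  pure-red-green⁻ : ∀ i → Pure (neighbour green (neighbour red i)) → Pure i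
  pure-red-green⁻ i p =
    pure-neighbour⁻ {red} i (λ ()) (pure-neighbour⁻ {green} (neighbour red i) (λ ()) p)

-- Squares fitted to a vertex of H

PureIndex : ∀ {m} → ℕ → Fin m → Set
PureIndex k i = toℕ i ≡ 0 ⊎ k < toℕ i

record SeparatedSquare (m k : ℕ) : Set₁ where
  field
    {Column}    : Set
    latinSquare : LatinSquare (Fin m) Column (Fin m)
  open LatinSquare latinSquare public
  field
    redColumn greenColumn : Column
    red≢green   : redColumn ≢ greenColumn
    pure-swap   : ∀ i → PureIndex k i → PureIndex k (entry (row redColumn i) greenColumn)
    pure-swap⁻  : ∀ i → PureIndex k (entry (row redColumn i) greenColumn) → PureIndex k i

separatedSquare : ∀ {m k} → 2 ≤ k → 2 + k ≤ m → SeparatedSquare m k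
separatedSquare {suc zero}          {suc (suc k)} _   (s≤s ())
separatedSquare {suc (suc zero)}    {suc (suc k)} _   (s≤s (s≤s ()))
separatedSquare {suc (suc (suc n))} {k}           2≤k k+2≤m = record
  { latinSquare = Separated.latinSquare 2≤k k+2≤m
  ; redColumn   = inj₁ red
  ; greenColumn = inj₁ green
  ; red≢green   = λ ()
  ; pure-swap   = Separated.pure-red-green 2≤k k+2≤m
  ; pure-swap⁻  = Separated.pure-red-green⁻ 2≤k k+2≤m
  }

-- Since `j ∗ e` is `j`, invariance of `Pure` under `_∗ w` says that the columns `e` and `w` have
-- the same entries, as sets, on the pure rows.
record StarSquare {k : ℕ} (fan : Fin (suc k) → A) : Set₁ where
  e : A
  e = fan zero
  field
    subtraction : Subtraction A e
  open Subtraction subtraction public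
  field
    w        : A
    w≢e      : w ≢ e
    Pure     : A → Set
    pure?    : ∀ j → Dec (Pure j)
    pure-e   : Pure e
    impure   : ∀ a → ¬ Pure (fan (suc a))
    impure⇒∈ : ∀ {j} → ¬ Pure j → ∃[ a ] fan (suc a) ≡ j
    pure-∗w  : ∀ j → Pure j → Pure (j ∗ w)
    pure-∗w⁻ : ∀ j → Pure (j ∗ w) → Pure j

-- The labels 0 to `k` are given to the fan, so the path from 1 to `k` becomes the set of impure
-- vertices. The red column is normalized to the unit, and the green one becomes `w`.
starSquare : DecidableEquality A → ∀ {m k} → Fin m ↔ A → 2 ≤ k → 2 + k ≤ m →
             (fan : Fin (suc k) → A) → (∀ {i j} → fan i ≡ fan j → i ≡ j) → StarSquare fan
starSquare {A} _≟_ {suc m} {k} enumeration 2≤k k+2≤m fan fan-injective = record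
  { subtraction = subtraction
  ; w           = fromColumn greenColumn
  ; w≢e         = λ w≡e → red≢green (trans (sym columnOf-unit)
                    (trans (cong columnOf (sym w≡e)) (columnOf-fromColumn greenColumn)))
  ; Pure        = PureIndex k ∘ from
  ; pure?       = λ j → (toℕ (from j) ℕ.≟ 0) ⊎-dec (k ℕ.<? toℕ (from j))
  ; pure-e      = inj₁ (cong toℕ from-unit)
  ; impure      = impure
  ; impure⇒∈    = impure⇒∈
  ; pure-∗w     = λ j p → subst (PureIndex k) (sym (from-∗-fromColumn j greenColumn)) (pure-swap (from j) p)
  ; pure-∗w⁻    = λ j p → pure-swap⁻ (from j) (subst (PureIndex k) (from-∗-fromColumn j greenColumn) p)
  }
  where
  open SeparatedSquare (separatedSquare 2≤k k+2≤m)

  k+1≤m : suc k ≤ suc m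
  k+1≤m = ℕ.<⇒≤ k+2≤m

  labelling : Σ[ φ ∈ Fin (suc m) ↔ A ] (∀ i → Inverse.to φ (inject≤ i k+1≤m) ≡ fan i)
  labelling = Swap.extend-injection _≟_ k+1≤m fan fan-injective enumeration

  φ = proj₁ labelling
  open Inverse φ using (to; from; strictlyInverseʳ)

  open Normalize latinSquare φ redColumn zero (proj₂ labelling zero)
  open Subtraction subtraction

  from-fan : ∀ i → toℕ (from (fan i)) ≡ toℕ i
  from-fan i = begin
    toℕ (from (fan i))                      ≡⟨ cong (toℕ ∘ from) (proj₂ labelling i) ⟨
    toℕ (from (to (inject≤ i k+1≤m)))       ≡⟨ cong toℕ (strictlyInverseʳ _) ⟩
    toℕ (inject≤ i k+1≤m)                   ≡⟨ Fin.toℕ-inject≤ i k+1≤m ⟩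
    toℕ i                                   ∎
    where open ≡-Reasoning

  impure : ∀ a → ¬ PureIndex k (from (fan (suc a)))
  impure a (inj₁ eq) = contradiction (trans (sym (from-fan (suc a))) eq) λ ()
  impure a (inj₂ k<) = ℕ.<⇒≱ (subst (k <_) (from-fan (suc a)) k<) (toℕ<n a)

  impure⇒∈ : ∀ {j} → ¬ PureIndex k (from j) → ∃[ a ] fan (suc a) ≡ j
  impure⇒∈ {j} ¬pure with toℕ (from j) in eq
  ... | zero  = contradiction (inj₁ refl) ¬pure
  ... | suc t = fromℕ< t<k , ↔-injective (↔-sym φ) (toℕ-injective
                  (trans (from-fan (suc (fromℕ< t<k))) (trans (cong suc (toℕ-fromℕ< t<k)) (sym eq))))
    where
    t<k : t < k
    t<k = ℕ.≮⇒≥ (¬pure ∘ inj₂)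

-- The hamiltonian cycles of the wreath product

-- The path starts at a value of `f`, so even the empty path ends at one.
predecessor : {f : A → A} {x y : A} → Reach f (f x) y → ∃[ p ] f p ≡ y
predecessor {x = x} ε = x , refl
predecessor (refl ◅ p) = predecessor p

-- Removing a point from a cyclic permutation and inserting it elsewhere

module Contract (_≟_ : DecidableEquality A) where

  module _ (e : A) where
    -- Contraction of the arc from `e` to `j`: whatever arrives at `e` is passed on to `j`.
    divert : A → A → A
    divert j x with x ≟ e
    ... | yes _ = j
    ... | no  _ = x

    divert-e : ∀ {j x} → x ≡ e → divert j x ≡ j
    divert-e {j} {x} x≡e with x ≟ e
    ... | yes _   = refl
    ... | no  x≢e = contradiction x≡e x≢e

    divert-≢ : ∀ {j x} → x ≢ e → divert j x ≡ x
    divert-≢ {j} {x} x≢e with x ≟ e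
    ... | yes x≡e = contradiction x≡e x≢e
    ... | no  _   = refl

    divert≢e : ∀ {j} x → j ≢ e → divert j x ≢ e
    divert≢e {j} x j≢e with x ≟ e
    ... | yes _   = j≢e
    ... | no  x≢e = x≢e

  module Bypass (e : A) (σ : A → A) (σe≢e : σ e ≢ e) (transitive : ∀ x y → Reach σ x y) where
    bypass : A → A
    bypass x with x ≟ e
    ... | yes _ = e
    ... | no  _ = divert e (σ e) (σ x)

    bypass-e : bypass e ≡ e
    bypass-e with e ≟ e
    ... | yes _   = refl
    ... | no  e≢e = contradiction refl e≢e

    bypass-≢ : ∀ {x} → x ≢ e → bypass x ≡ divert e (σ e) (σ x)
    bypass-≢ {x} x≢e with x ≟ e
    ... | yes x≡e = contradiction x≡e x≢e
    ... | no  _   = refl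

    bypass≢e : ∀ {x} → x ≢ e → bypass x ≢ e
    bypass≢e {x} x≢e eq = divert≢e e (σ x) σe≢e (trans (sym (bypass-≢ x≢e)) eq)

    -- A path of `σ` is projected by replacing `e` with `σ e`: the step out of `e` disappears and
    -- every other one becomes a step of `bypass`.
    bypass-transitive : ∀ {x y} → x ≢ e → y ≢ e → Reach bypass x y
    bypass-transitive {x} {y} x≢e y≢e =
      subst₂ (Reach bypass) (divert-≢ e x≢e) (divert-≢ e y≢e) (diverted (transitive x y))
      where
      diverted : ∀ {x y} → Reach σ x y → Reach bypass (divert e (σ e) x) (divert e (σ e) y)
      diverted ε = ε
      diverted {x} {y} (refl ◅ p) with x ≟ e
      ... | yes refl = subst (λ z → Reach bypass z (divert e (σ e) y)) (divert-≢ e {σ e} {σ e} σe≢e) (diverted p)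
      ... | no  x≢e  = bypass-≢ x≢e ◅ diverted p

    bypass-surjective : ∀ {y} → y ≢ e → ∃[ x ] (x ≢ e × bypass x ≡ y)
    bypass-surjective {y} y≢e with x , eq ← predecessor (bypass-transitive (bypass≢e y≢e) y≢e) =
      x , (λ { refl → y≢e (trans (sym eq) bypass-e) }) , eq

    open Swap _≟_

    module Insert {w : A} (w≢e : w ≢ e) where
      insert : A → A
      insert x = swap e w (bypass x)

      insert-e : insert e ≡ w
      insert-e = trans (cong (swap e w) bypass-e) (swapˡ e w)

      insert-w : ∀ {x} → bypass x ≡ w → insert x ≡ e
      insert-w eq = trans (cong (swap e w) eq) (swapʳ e w)

      -- The step of `bypass` into `w` becomes a detour through `e`; all other steps are kept.
      bypass⇒insert : ∀ {x y} → x ≢ e → Reach bypass x y → Reach insert x y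
      bypass⇒insert x≢e ε = ε
      bypass⇒insert {x} x≢e (refl ◅ p) = step (bypass x ≟ w) ◅◅ bypass⇒insert (bypass≢e x≢e) p
        where
        step : Dec (bypass x ≡ w) → Reach insert x (bypass x)
        step (yes θx≡w) = insert-w θx≡w ◅ trans insert-e (sym θx≡w) ◅ ε
        step (no  θx≢w) = swap-fixes (bypass≢e x≢e) θx≢w ◅ ε

      insert-reaches : ∀ y → Reach insert w y
      insert-reaches y with y ≟ e
      ... | no  y≢e  = bypass⇒insert w≢e (bypass-transitive w≢e y≢e)
      ... | yes refl with x , x≢e , eq ← bypass-surjective w≢e =
        bypass⇒insert w≢e (bypass-transitive w≢e x≢e) ▻ʳ insert-w eq

-- Turns through the layers

module Sweep (C : SpanningCycle B) where
  open SpanningCycle C using (length; 2≤length)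
  open Successor C

  -- `Good` will be all of `A` for switched rows and `_≢ e` for impure ones. A passage between
  -- layers is a path, since an impure cycle may need an extra step inside the layer.
  module _
    (even : parity length ≡ true)
    (f : B × A → B × A) (Good : A → Set) (θ ρ κ : A → A)
    (θ-good : ∀ {x} → Good x → Good (θ x))
    (κ-good : ∀ {x} → Good x → Good (κ x))
    (first  : ∀ {x} → Good x → Reach f (f (at 0 , x)) (at 1 , ρ (θ x)))
    (up     : ∀ t {x} → t ≢ 0 → suc t < length → parity t ≡ true → Good x →
              Reach f (at t , x) (at (suc t) , ρ x))
    (down   : ∀ t {x} → suc t < length → parity t ≡ false → Good x →
              Reach f (at t , ρ x) (at (suc t) , x))
    (last   : ∀ t {x} → suc t ≡ length → parity t ≡ false → Good x →
              Reach f (at t , ρ x) (at (suc t) , κ x))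
    where

    level : ℕ → A → A
    level t x = if parity t then x else ρ x

    climb : ∀ t {x} → suc t < length → Good x → Reach f (f (at 0 , x)) (at (suc t) , level (suc t) (θ x))
    climb zero        _   good = first good
    climb (suc t) {x} t+2<l good = climb t t+1<l good ◅◅ step
      where
      t+1<l = ℕ.<-trans (ℕ.n<1+n (suc t)) t+2<l
      step : Reach f (at (suc t) , level (suc t) (θ x)) (at (suc (suc t)) , level (suc (suc t)) (θ x))
      step with parity (suc t) in eq
      ... | true  = up (suc t) (λ ()) t+2<l eq (θ-good good)
      ... | false = down (suc t) t+2<l eq (θ-good good)

    -- As the length is even, the passages by `ρ` and back cancel in pairs, so the return map to the
    -- first layer is `κ ∘ θ`.
    turn : ∀ {x} → Good x → Reach f (f (at 0 , x)) (at 0 , κ (θ x))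
    turn {x} good = subst (λ b → Reach f (f (at 0 , x)) (b , κ (θ x)))
      (trans (cong at l≡) at-length)
      (climb l (ℕ.≤-reflexive l≡) good ◅◅
       subst (λ z → Reach f (at (suc l) , z) (at (suc (suc l)) , κ (θ x)))
             (sym (cong (λ b → if b then θ x else ρ (θ x)) odd))
             (last (suc l) l≡ odd (θ-good good)))
      where
      -- The last layer is `suc l`, which is odd.
      l = length ∸ 2
      l≡ : suc (suc l) ≡ length
      l≡ = ℕ.m+[n∸m]≡n 2≤length
      odd : parity (suc l) ≡ false
      odd = not-injective (trans (cong parity l≡) even)

    turns : ∀ {x y} → Good x → Reach (κ ∘ θ) x y → Reach f (at 0 , x) (at 0 , y)
    turns good ε          = ε
    turns good (refl ◅ p) = (refl ◅ turn good) ◅◅ turns (κ-good (θ-good good)) p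

    module _
      (θ-surjective : ∀ {y} → Good y → ∃[ x ] (Good x × θ x ≡ y))
      (ρ-surjective : ∀ {y} → Good y → ∃[ x ] (Good x × ρ x ≡ y))
      {b : A} (b-good : Good b) (transitive : ∀ {y} → Good y → Reach (κ ∘ θ) (κ (θ b)) y)
      where

      level-surjective : ∀ t {y} → Good y → ∃[ x ] (Good x × level t (θ x) ≡ y)
      level-surjective t good with parity t
      ... | true  = θ-surjective good
      ... | false with z , z-good , refl ← ρ-surjective good
                  with x , x-good , refl ← θ-surjective z-good = x , x-good , refl

      bottom : ∀ {y} → Good y → Reach f (f (at 0 , b)) (at 0 , y)
      bottom good = turn b-good ◅◅ turns (κ-good (θ-good b-good)) (transitive good)

      -- The vertex `y` is pulled back to the first layer, its preimage is reached by whole turns,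
      -- and one climb leads up to `y`.
      sweep-at : ∀ t {y} → t < length → Good y → Reach f (f (at 0 , b)) (at t , y)
      sweep-at zero    _    good = bottom good
      sweep-at (suc t) t+1<l good with x , x-good , eq ← level-surjective (suc t) good =
        bottom x-good ◅◅ (refl ◅ subst (λ z → Reach f (f (at 0 , x)) (at (suc t) , z)) eq (climb t t+1<l x-good))

      sweep : ∀ a {y} → Good y → Reach f (f (at 0 , b)) (a , y)
      sweep a good = subst (λ a → Reach f (f (at 0 , b)) (a , _)) (at-position a)
                           (sweep-at (position a) (position<length a) good)

-- The permutations decomposing the product

module Product {G H : Digraph} {c k : ℕ}
  (DG : HamiltonianDecomposition G (suc c)) (DH : HamiltonianDecomposition H (suc k))
  (even : ∀ t → parity (SpanningCycle.length (proj₁ (HamiltonianDecomposition.cycle DG t))) ≡ true)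
  (e₀ : V H) (square : StarSquare (Fan.fan DH e₀))
  where

  private
    module G = Successors DG
    module H = Successors DH
    module Layers t = G.Cycle t
    _≟_ = Digraph._≟_ H
    X = V H

  open G using () renaming (σ to τ)
  open H using (σ)
  open StarSquare square
  open Swap _≟_
  open Contract _≟_
  open Bypass e (σ zero) (H.σ-moves zero) (H.Cycle.successor-transitive zero)
    renaming (bypass to θ; bypass-e to θ-e; bypass≢e to θ≢e)
  open Insert w≢e

  layers : Fin (suc c) → ℕ
  layers t = SpanningCycle.length (proj₁ (HamiltonianDecomposition.cycle DG t))

  -- The rows closed by the transposition. Cycle `zero` of `G` is the one whose arcs are shared with
  -- the cycles following some `σ a`.
  Switched : Fin (suc c) → X → Set
  Switched zero    j = Pure j
  Switched (suc t) j = ⊤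

  switched? : ∀ t j → Dec (Switched t j)
  switched? zero    j = pure? j
  switched? (suc t) j = yes tt

  switched-∗w : ∀ t j → Switched t j → Switched t (j ∗ w)
  switched-∗w zero    = pure-∗w
  switched-∗w (suc t) = λ _ _ → tt

  switched-∗w⁻ : ∀ t j → Switched t (j ∗ w) → Switched t j
  switched-∗w⁻ zero    = pure-∗w⁻
  switched-∗w⁻ (suc t) = λ _ _ → tt

  switch : Fin (suc c) → X → X → X
  switch t j x with switched? t j
  ... | yes _ = swap e w x
  ... | no  _ = x

  switch-yes : ∀ t {j} x → Switched t j → switch t j x ≡ swap e w x
  switch-yes t {j} x s with switched? t j
  ... | yes _ = refl
  ... | no ¬s = contradiction s ¬s

  switch-no : ∀ t {j} x → ¬ Switched t j → switch t j x ≡ x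
  switch-no t {j} x ¬s with switched? t j
  ... | yes s = contradiction s ¬s
  ... | no  _ = refl

  switch-fixes : ∀ t j {x} → x ≢ e → x ≢ w → switch t j x ≡ x
  switch-fixes t j x≢e x≢w with switched? t j
  ... | yes _ = swap-fixes x≢e x≢w
  ... | no  _ = refl

  switch-involutive : ∀ t j x → switch t j (switch t j x) ≡ x
  switch-involutive t j x with switched? t j
  ... | yes _ = swap-involutive e w x
  ... | no  _ = refl

  -- In the columns `e` and `w` a switched row has only switched entries and an unswitched row only
  -- unswitched ones, so they cannot meet there. The other columns are not affected.
  mixed-impossible : ∀ t {j j′} → Switched t j → ¬ Switched t j′ → ∀ z → j ∗ swap e w z ≡ j′ ∗ z → j ≡ j′
  mixed-impossible t {j} {j′} s ¬s z eq = by-cases (z ≟ e) (z ≟ w)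
    where
    by-cases : Dec (z ≡ e) → Dec (z ≡ w) → j ≡ j′
    by-cases (yes refl) _ = contradiction
      (subst (Switched t) (trans (cong (j ∗_) (sym (swapˡ e w))) (trans eq (identityʳ j′))) (switched-∗w t j s)) ¬s
    by-cases (no _) (yes refl) = contradiction
      (switched-∗w⁻ t j′ (subst (Switched t) (trans (sym (identityʳ j)) (trans (cong (j ∗_) (sym (swapʳ e w))) eq)) s)) ¬s
    by-cases (no z≢e) (no z≢w) = ∗-cancelʳ z (trans (cong (j ∗_) (sym (swap-fixes z≢e z≢w))) eq)

  ∗switch-injective : ∀ t z {j j′} → j ∗ switch t j z ≡ j′ ∗ switch t j′ z → j ≡ j′
  ∗switch-injective t z {j} {j′} eq with switched? t j | switched? t j′
  ... | yes _ | yes _  = ∗-cancelʳ _ eq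
  ... | yes s | no ¬s  = mixed-impossible t s ¬s z eq
  ... | no ¬s | yes s  = sym (mixed-impossible t s ¬s z (sym eq))
  ... | no _  | no _   = ∗-cancelʳ _ eq

  -- In the columns `e` and `w` the wanted row is switched exactly when `y` is, which decides in
  -- which of the two original columns to look for `y`.
  ∗switch-surjective : ∀ t y z → ∃[ j ] j ∗ switch t j z ≡ y
  ∗switch-surjective t y z with z ≟ e | z ≟ w
  ... | no z≢e | no z≢w = y // z , trans (cong ((y // z) ∗_) (switch-fixes t (y // z) z≢e z≢w)) (rightDividesˡ z y)
  ... | yes refl | _ with switched? t y
  ...   | no ¬s = y , trans (cong (y ∗_) (switch-no t e ¬s)) (identityʳ y)
  ...   | yes s = y // w , trans (cong ((y // w) ∗_) (trans (switch-yes t e s′) (swapˡ e w))) (rightDividesˡ w y)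
    where s′ = switched-∗w⁻ t (y // w) (subst (Switched t) (sym (rightDividesˡ w y)) s)
  ∗switch-surjective t y z | no _ | yes refl with switched? t y
  ...   | yes s = y , trans (cong (y ∗_) (trans (switch-yes t w s) (swapʳ e w))) (identityʳ y)
  ...   | no ¬s = y // w , trans (cong ((y // w) ∗_) (switch-no t w ¬s′)) (rightDividesˡ w y)
    where ¬s′ = λ s → ¬s (subst (Switched t) (rightDividesˡ w y) (switched-∗w t (y // w) s))

  twist : ℕ → X → X
  twist zero    = θ
  twist (suc s) = id

  close : Fin (suc c) → ℕ → X → X → X
  close t s j y with suc s ℕ.≟ layers t
  ... | yes _ = switch t j y
  ... | no  _ = y

  close-last : ∀ t {s} j y → suc s ≡ layers t → close t s j y ≡ switch t j y
  close-last t {s} j y last with suc s ℕ.≟ layers t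
  ... | yes _    = refl
  ... | no ¬last = contradiction last ¬last

  close-inner : ∀ t {s} j y → suc s < layers t → close t s j y ≡ y
  close-inner t {s} j y s+1<l with suc s ℕ.≟ layers t
  ... | yes last = contradiction last (ℕ.<⇒≢ s+1<l)
  ... | no  _    = refl

  close-no : ∀ t {s} j y → ¬ Switched t j → close t s j y ≡ y
  close-no t {s} j y ¬s with suc s ℕ.≟ layers t
  ... | yes _ = switch-no t y ¬s
  ... | no  _ = refl

  π : Fin (suc c) → ℕ → X → X → X
  π t s j x = if parity s then j ∗ twist s x else close t s j (j \\ x)

  π-up : ∀ t {s} j x → parity s ≡ true → π t s j x ≡ j ∗ twist s x
  π-up t {s} j x eq = cong (λ b → if b then j ∗ twist s x else close t s j (j \\ x)) eq

  π-down : ∀ t {s} j x → parity s ≡ false → π t s j x ≡ close t s j (j \\ x)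
  π-down t {s} j x eq = cong (λ b → if b then j ∗ twist s x else close t s j (j \\ x)) eq

  π-injective : ∀ t s x {j j′} → π t s j x ≡ π t s j′ x → j ≡ j′
  π-injective t s x {j} {j′} eq with parity s
  ... | true = ∗-cancelʳ _ eq
  ... | false with suc s ℕ.≟ layers t
  ...   | no  _ = ∗-cancelʳ (j \\ x) (trans (leftDividesˡ j x)
                    (trans (sym (leftDividesˡ j′ x)) (cong (j′ ∗_) (sym eq))))
  -- Solved for `x`, the closing permutation is `j ∗ switch t j y`, to which the Latin property of
  -- the switched rows applies.
  ...   | yes _ = ∗switch-injective t (switch t j (j \\ x)) (begin
    j ∗ switch t j (switch t j (j \\ x))       ≡⟨ cong (j ∗_) (switch-involutive t j _) ⟩
    j ∗ (j \\ x)                               ≡⟨ leftDividesˡ j x ⟩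
    x                                          ≡⟨ leftDividesˡ j′ x ⟨
    j′ ∗ (j′ \\ x)                             ≡⟨ cong (j′ ∗_) (switch-involutive t j′ _) ⟨
    j′ ∗ switch t j′ (switch t j′ (j′ \\ x))   ≡⟨ cong (λ z → j′ ∗ switch t j′ z) eq ⟨
    j′ ∗ switch t j′ (switch t j (j \\ x))     ∎)
    where open ≡-Reasoning

  π-surjective : ∀ t s x y → ∃[ j ] π t s j x ≡ y
  π-surjective t s x y with parity s
  ... | true = y // twist s x , rightDividesˡ (twist s x) y
  ... | false with suc s ℕ.≟ layers t
  ...   | no  _ = x // y , trans (cong ((x // y) \\_) (sym (rightDividesˡ y x))) (leftDividesʳ (x // y) y)
  ...   | yes _ with j , eq ← ∗switch-surjective t x y = j , (begin
    switch t j (j \\ x)                   ≡⟨ cong (λ z → switch t j (j \\ z)) eq ⟨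
    switch t j (j \\ (j ∗ switch t j y))  ≡⟨ cong (switch t j) (leftDividesʳ j _) ⟩
    switch t j (switch t j y)             ≡⟨ switch-involutive t j y ⟩
    y                                     ∎)
    where open ≡-Reasoning

  twist-e : ∀ s → twist s e ≡ e
  twist-e zero    = θ-e
  twist-e (suc s) = refl

  -- Hence the arcs between layers that an impure row gives up at `e` are those by which the cycles
  -- following `σ a` leave a layer.
  π-e : ∀ s {j} → ¬ Pure j → π zero s j e ≡ j
  π-e s {j} ¬pure with parity s
  ... | true  = trans (cong (j ∗_) (twist-e s)) (identityʳ j)
  ... | false = trans (close-no zero j (j \\ e) ¬pure) (\\-unit j)

  -- `inj₁ a` stands for the cycle that follows `σ a` inside the layers, and `inj₂ (t , j)` for the
  -- one that runs along cycle `t` of `G` by row `j`.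
  Index : Set
  Index = Fin (suc k) ⊎ (Fin (suc c) × X)

  Moves : Index → X → Set
  Moves (inj₁ a)       x = x ≡ e
  Moves (inj₂ (t , j)) x = Switched t j ⊎ x ≢ e

  moves? : ∀ i x → Dec (Moves i x)
  moves? (inj₁ a)       x = x ≟ e
  moves? (inj₂ (t , j)) x = switched? t j ⊎-dec ¬? (x ≟ e)

  direction : Index → Fin (suc c)
  direction (inj₁ a)       = zero
  direction (inj₂ (t , j)) = t

  across : Index → V G → X → X
  across (inj₁ a)       g x = σ a x
  across (inj₂ (t , j)) g x = π t (Layers.position t g) j x

  within : Index → X → X
  within (inj₁ a)       x = σ a x
  within (inj₂ (t , j)) x = j

  f : Index → V G × X → V G × X
  f i (g , x) with moves? i x
  ... | yes _ = τ (direction i) g , across i g x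
  ... | no  _ = g , within i x

  f-moves : ∀ i {g x} → Moves i x → f i (g , x) ≡ (τ (direction i) g , across i g x)
  f-moves i {g} {x} m with moves? i x
  ... | yes _ = refl
  ... | no ¬m = contradiction m ¬m

  f-stays : ∀ i {g x} → ¬ Moves i x → f i (g , x) ≡ (g , within i x)
  f-stays i {g} {x} ¬m with moves? i x
  ... | yes m = contradiction m ¬m
  ... | no  _ = refl

  stays : ∀ {t j x} → ¬ Moves (inj₂ (t , j)) x → x ≡ e × ¬ Switched t j
  stays {x = x} ¬m = decidable-stable (x ≟ e) (¬m ∘ inj₂) , ¬m ∘ inj₁

  ¬switched⇒zero : ∀ {t j} → ¬ Switched t j → t ≡ zero × ¬ Pure j
  ¬switched⇒zero {zero}  ¬s = refl , ¬s
  ¬switched⇒zero {suc t} ¬s = contradiction tt ¬s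

  f-arc : ∀ i p → (G ≀ H) [ p ⟶ f i p ]
  f-arc i (g , x) with moves? i x
  f-arc i              (g , x) | yes _ = inj₁ (G.σ-arc (direction i) g)
  f-arc (inj₁ a)       (g , x) | no  _ = inj₂ (refl , H.σ-arc a x)
  f-arc (inj₂ (t , j)) (g , x) | no ¬m with refl , ¬s ← stays {t} ¬m
    with _ , ¬pure ← ¬switched⇒zero {t} ¬s with a , refl ← impure⇒∈ ¬pure = inj₂ (refl , H.σ-arc a e)

  -- Only the row of `σ a e` itself would use this arc, and that row is impure and stays in its
  -- layer at `e`.
  star-row : ∀ s {a t j} → zero ≡ t → Moves (inj₂ (t , j)) e → σ a e ≢ π t s j e
  star-row s {a} {j = j} refl m eq
    with refl ← π-injective zero s e {σ a e} {j} (trans (π-e s (impure a)) eq) with m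
  ... | inj₁ pure = impure a pure
  ... | inj₂ e≢e  = e≢e refl

  across-injective : ∀ i i′ {g x} → Moves i x → Moves i′ x → direction i ≡ direction i′ →
                     across i g x ≡ across i′ g x → i ≡ i′
  across-injective (inj₁ a) (inj₁ a′) m m′ d eq = cong inj₁ (H.σ-injective _ eq)
  across-injective (inj₁ a) (inj₂ (t , j)) refl m′ d eq = contradiction eq (star-row _ d m′)
  across-injective (inj₂ (t , j)) (inj₁ a) m refl d eq = contradiction (sym eq) (star-row _ (sym d) m)
  across-injective (inj₂ (t , j)) (inj₂ (.t , j′)) {g} {x} m m′ refl eq =
    cong (λ j → inj₂ (t , j)) (π-injective t (Layers.position t g) x eq)

  within-injective : ∀ i i′ {x} → ¬ Moves i x → ¬ Moves i′ x → within i x ≡ within i′ x → i ≡ i′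
  within-injective (inj₁ a) (inj₁ a′) _ _ eq = cong inj₁ (H.σ-injective _ eq)
  within-injective (inj₁ a) (inj₂ (t , j)) ¬m ¬m′ eq = contradiction (proj₁ (stays {t} ¬m′)) ¬m
  within-injective (inj₂ (t , j)) (inj₁ a) ¬m ¬m′ eq = contradiction (proj₁ (stays {t} ¬m)) ¬m′
  within-injective (inj₂ (t , j)) (inj₂ (t′ , .j)) ¬m ¬m′ refl
    with refl , _ ← ¬switched⇒zero {t} {j} (proj₂ (stays {t} ¬m))
    with refl , _ ← ¬switched⇒zero {t′} {j} (proj₂ (stays {t′} ¬m′)) = refl

  f-injective : ∀ p {i i′} → f i p ≡ f i′ p → i ≡ i′
  f-injective (g , x) {i} {i′} eq with moves? i x | moves? i′ x
  ... | yes m | yes m′ = across-injective i i′ m m′ (G.σ-injective g (cong proj₁ eq)) (cong proj₂ eq)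
  ... | yes _ | no _   = contradiction (cong proj₁ eq) (G.σ-moves (direction i))
  ... | no _  | yes _  = contradiction (sym (cong proj₁ eq)) (G.σ-moves (direction i′))
  ... | no ¬m | no ¬m′ = within-injective i i′ ¬m ¬m′ (cong proj₂ eq)

  f-covers : ∀ {p q} → (G ≀ H) [ p ⟶ q ] → ∃[ i ] f i p ≡ q
  f-covers {g , x} {g′ , y} (inj₁ g⟶g′)
    with t , refl ← G.σ-covers g⟶g′
    with j , eq ← π-surjective t (Layers.position t g) x y
    with moves? (inj₂ (t , j)) x
  ... | yes m = inj₂ (t , j) , trans (f-moves (inj₂ (t , j)) m) (cong (τ t g ,_) eq)
  -- The row that would use this arc stays at `e`, so the arc belongs to a cycle of the first kind.
  ... | no ¬m with refl , ¬s ← stays {t} ¬m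
              with refl , ¬pure ← ¬switched⇒zero {t} ¬s
              with a , refl ← impure⇒∈ ¬pure =
    inj₁ a , trans (f-moves (inj₁ a) refl) (cong (τ zero g ,_) (trans (sym (π-e _ ¬pure)) eq))
  f-covers {g , x} {g′ , y} (inj₂ (refl , x⟶y)) with a , refl ← H.σ-covers x⟶y with x ≟ e
  ... | no x≢e   = inj₁ a , f-stays (inj₁ a) x≢e
  -- The cycle following `σ a` leaves the layer at `e`, so the arc inside the layer falls to an
  -- impure row.
  ... | yes refl = inj₂ (zero , σ a e) , f-stays (inj₂ (zero , σ a e))
                     λ { (inj₁ pure) → impure a pure ; (inj₂ e≢e) → e≢e refl }

  at : Fin (suc c) → ℕ → V G
  at = Layers.at

  f-at : ∀ t s j {x} → s < layers t → Moves (inj₂ (t , j)) x →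
         f (inj₂ (t , j)) (at t s , x) ≡ (at t (suc s) , π t s j x)
  f-at t s j {x} s<l m = trans (f-moves (inj₂ (t , j)) m)
    (cong₂ _,_ (Layers.successor-at t s) (cong (λ p → π t p j x) (Layers.position-at t s<l)))

  0<layers : ∀ t → 0 < layers t
  0<layers t = ℕ.≤-trans (s≤s z≤n) (SpanningCycle.2≤length (proj₁ (HamiltonianDecomposition.cycle DG t)))

  -- Every layer is entered at `σ a e` and traversed by `σ a` up to `e`, from where the next layer
  -- is entered again at `σ a e`.
  spanning-cycle : ∀ a → IsCycle (f (inj₁ a))
  spanning-cycle a = (at zero 0 , e) , λ (g , y) →
    subst (λ p → Reach (f (inj₁ a)) p (g , y)) (sym (leave refl))
      (lift (Layers.successor-transitive zero _ g) ◅◅ layer g y)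
    where
    F = f (inj₁ a)

    leave : ∀ {g x} → x ≡ e → F (g , x) ≡ (τ zero g , σ a x)
    leave x≡e = f-moves (inj₁ a) x≡e

    stay : ∀ {g x} → x ≢ e → F (g , x) ≡ (g , σ a x)
    stay x≢e = f-stays (inj₁ a) x≢e

    along : ∀ {g x y} → Reach (σ a) x y → Reach F (g , σ a e) (g , x) → Reach F (g , σ a e) (g , y)
    along ε p = p
    along {x = x} (refl ◅ q) p with x ≟ e
    -- After `e` the path of `σ a` is back at the entry point, so the path so far is dropped.
    ... | yes refl = along q ε
    ... | no  x≢e  = along q (p ▻ʳ stay x≢e)

    layer : ∀ g y → Reach F (g , σ a e) (g , y)
    layer g y = along (H.Cycle.successor-transitive a (σ a e) y) ε

    lift : ∀ {g g′} → Reach (τ zero) g g′ → Reach F (g , σ a e) (g′ , σ a e)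
    lift ε = ε
    lift {g} (refl ◅ q) = (layer g e ▻ʳ leave refl) ◅◅ lift q

  ≡⇒Reach : {h : V G × X → V G × X} {p q : V G × X} → p ≡ q → Reach h p q
  ≡⇒Reach refl = ε

  cycleOf : Fin (suc c) → SpanningCycle (V G)
  cycleOf t = proj₁ (HamiltonianDecomposition.cycle DG t)

  θ-surjective : ∀ y → ∃[ x ] θ x ≡ y
  θ-surjective y with y ≟ e
  ... | yes refl = e , θ-e
  ... | no  y≢e  = let x , _ , eq = bypass-surjective y≢e in x , eq

  twist-inner : ∀ {s} x → s ≢ 0 → twist s x ≡ x
  twist-inner {zero}  x s≢0 = contradiction refl s≢0
  twist-inner {suc s} x s≢0 = refl

  -- The return map to the first layer is `insert`, a single cycle on all vertices of `H`.
  switched-cycle : ∀ t j → Switched t j → IsCycle (f (inj₂ (t , j)))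
  switched-cycle t j sw = (at t 0 , e) , λ (g , y) →
    Sweep.sweep (cycleOf t) (even t) F (λ _ → ⊤) θ (j ∗_) (swap e w) (λ _ → tt) (λ _ → tt)
      (λ _ → ≡⇒Reach (step (0<layers t)))
      (λ s {x} s≢0 s+1<l eq _ → trans (step (ℕ.<⇒≤ s+1<l))
        (cong (at t (suc s) ,_) (trans (π-up t {s} j x eq) (cong (j ∗_) (twist-inner x s≢0)))) ◅ ε)
      (λ s {x} s+1<l eq _ → trans (step (ℕ.<⇒≤ s+1<l))
        (cong (at t (suc s) ,_) (trans (π-down t {s} j (j ∗ x) eq)
          (trans (close-inner t j _ s+1<l) (leftDividesʳ j x)))) ◅ ε)
      (λ s {x} s+1≡l eq _ → trans (step (ℕ.≤-reflexive s+1≡l))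
        (cong (at t (suc s) ,_) (trans (π-down t {s} j (j ∗ x) eq)
          (trans (close-last t j _ s+1≡l) (trans (switch-yes t _ sw)
            (cong (swap e w) (leftDividesʳ j x)))))) ◅ ε)
      (λ {y} _ → let x , eq = θ-surjective y in x , tt , eq)
      (λ {y} _ → j \\ y , tt , leftDividesˡ j y)
      tt (λ {y} _ → subst (λ z → Reach insert z y) (sym insert-e) (insert-reaches y)) g {y} tt
    where
    F = f (inj₂ (t , j))

    step : ∀ {s x} → s < layers t → F (at t s , x) ≡ (at t (suc s) , π t s j x)
    step {s} s<l = f-at t s j s<l (inj₁ sw)

  -- With the arc from `e` to `j` contracted in every layer, the return map is `θ`, a single cycle
  -- on the vertices other than `e`. The copies of `e` are treated separately.
  impure-cycle : ∀ j → ¬ Pure j → IsCycle (f (inj₂ (zero , j)))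
  impure-cycle j ¬pure = (at zero 0 , w) , reaches
    where
    F = f (inj₂ (zero , j))

    j≢e : j ≢ e
    j≢e refl = ¬pure pure-e

    ρ : X → X
    ρ x = divert e j (j ∗ x)

    unρ : X → X
    unρ x = divert e j (j \\ x)

    -- The only exception is `j` itself, which `j ∗_` and its inverse both send to `e`, and the
    -- diversion sends `e` back to `j`.
    unρ-ρ : ∀ {x} → x ≢ e → unρ (ρ x) ≡ x
    unρ-ρ {x} x≢e = by-cases ((j ∗ x) ≟ e)
      where
      by-cases : Dec (j ∗ x ≡ e) → unρ (ρ x) ≡ x
      by-cases (yes eq) = trans (cong unρ (divert-e e eq))
        (trans (divert-e e (\\-self j)) (∗-cancelˡ j (trans (unipotent j) (sym eq))))
      by-cases (no j∗x≢e) = trans (cong unρ (divert-≢ e j∗x≢e))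
        (trans (cong (divert e j) (leftDividesʳ j x)) (divert-≢ e x≢e))

    ρ-unρ : ∀ {x} → x ≢ e → ρ (unρ x) ≡ x
    ρ-unρ {x} x≢e = by-cases ((j \\ x) ≟ e)
      where
      by-cases : Dec (j \\ x ≡ e) → ρ (unρ x) ≡ x
      by-cases (yes eq) = trans (cong ρ (divert-e e eq)) (trans (divert-e e (unipotent j))
        (trans (sym (identityʳ j)) (trans (cong (j ∗_) (sym eq)) (leftDividesˡ j x))))
      by-cases (no j\\x≢e) = trans (cong ρ (divert-≢ e j\\x≢e))
        (trans (cong (divert e j) (leftDividesˡ j x)) (divert-≢ e x≢e))

    step : ∀ {s x} → s < layers zero → x ≢ e → F (at zero s , x) ≡ (at zero (suc s) , π zero s j x)
    step {s} s<l x≢e = f-at zero s j s<l (inj₂ x≢e)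

    settle : ∀ g x → Reach F (g , x) (g , divert e j x)
    settle g x with x ≟ e
    ... | no  _    = ε
    ... | yes refl = f-stays (inj₂ (zero , j)) (λ { (inj₁ p) → ¬pure p ; (inj₂ e≢e) → e≢e refl }) ◅ ε

    hop : ∀ {s x y} → s < layers zero → x ≢ e → divert e j (π zero s j x) ≡ y →
          Reach F (F (at zero s , x)) (at zero (suc s) , y)
    hop s<l x≢e refl = ≡⇒Reach (step s<l x≢e) ◅◅ settle _ _

    hop-down : ∀ s {x} → s < layers zero → parity s ≡ false → x ≢ e →
               Reach F (at zero s , ρ x) (at zero (suc s) , x)
    hop-down s {x} s<l eq x≢e = refl ◅ hop s<l (divert≢e e _ j≢e)
      (trans (cong (divert e j) (trans (π-down zero {s} j (ρ x) eq) (close-no zero j _ ¬pure))) (unρ-ρ x≢e))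

    sweep : ∀ g {y} → y ≢ e → Reach F (F (at zero 0 , w)) (g , y)
    sweep = Sweep.sweep (cycleOf zero) (even zero) F (_≢ e) θ ρ id θ≢e id
      (λ x≢e → hop (0<layers zero) x≢e refl)
      (λ s {x} s≢0 s+1<l eq x≢e → refl ◅ hop (ℕ.<⇒≤ s+1<l) x≢e
        (cong (divert e j) (trans (π-up zero {s} j x eq) (cong (j ∗_) (twist-inner x s≢0)))))
      (λ s s+1<l → hop-down s (ℕ.<⇒≤ s+1<l))
      (λ s s+1≡l → hop-down s (ℕ.≤-reflexive s+1≡l))
      bypass-surjective
      (λ {y} y≢e → unρ y , divert≢e e _ j≢e , ρ-unρ y≢e)
      w≢e (bypass-transitive (θ≢e w≢e))

    -- The sweep misses the copies of `e`, so each needs a predecessor other than `e`. It is `j`, or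
    -- the preimage of `j` under `θ` where `θ` is applied first.
    enter-e : ∀ s → ∃[ x ] (x ≢ e × π zero s j x ≡ e)
    enter-e s with parity s
    ... | false = j , j≢e , trans (close-no zero j (j \\ j) ¬pure) (\\-self j)
    enter-e zero    | true = let x , x≢e , eq = bypass-surjective j≢e in
      x , x≢e , trans (cong (j ∗_) eq) (unipotent j)
    enter-e (suc s) | true = j , j≢e , unipotent j

    reaches : ∀ p → Reach F (F (at zero 0 , w)) p
    reaches (g , y) with y ≟ e
    ... | no y≢e   = sweep g y≢e
    ... | yes refl with s , s<l , refl ← Layers.predecessor-at zero g with x , x≢e , eq ← enter-e s =
      sweep (at zero s) x≢e ▻ʳ trans (step s<l x≢e) (cong (at zero (suc s) ,_) eq)

  f-cycle : ∀ i → IsCycle (f i)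
  f-cycle (inj₁ a) = spanning-cycle a
  f-cycle (inj₂ (t , j)) = by-cases t (switched? t j)
    where
    by-cases : ∀ t → Dec (Switched t j) → IsCycle (f (inj₂ (t , j)))
    by-cases t       (yes s)     = switched-cycle t j s
    by-cases zero    (no ¬pure)  = impure-cycle j ¬pure
    by-cases (suc t) (no ¬s)     = contradiction tt ¬s

  #cycles : ℕ
  #cycles = suc k + suc c * order H

  hamiltonianDecomposition : HamiltonianDecomposition (G ≀ H) #cycles
  hamiltonianDecomposition = decomposition (G ≀ H)
    ((↔-refl ⊎-↔ ((↔-refl ×-↔ Digraph.enumeration H) ↔-∘ Fin.*↔×)) ↔-∘ Fin.+↔⊎)
    f f-cycle f-arc f-injective f-covers

parity-double : ∀ n → parity (n * 2) ≡ true
parity-double zero    = refl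
parity-double (suc n) = trans (not-involutive (parity (n * 2))) (parity-double n)

theorem1p5 : (G H : Digraph) →
    HamiltonianDecomposable G →
    HamiltonianDecomposable H →
    Even (order G) →
    3 < order H →
    ¬ IsDirectedCycle H →
    ¬ IsCompleteSymmetric H →
    ¬ (IsDirectedCycle G
    × Even (order H)
    × (∃[ k ] (Odd k × HamiltonianDecomposition H k))) →
    HamiltonianDecomposable (G ≀ H)
theorem1p5 G H (suc c , _ , DG) (suc k , _ , DH) (divides n order≡) _ ¬cycle ¬complete _ =
  Product.#cycles DG DH even e₀ square , s≤s z≤n , Product.hamiltonianDecomposition DG DH even e₀ square
  where
  cycleOf : Fin (suc c) → SpanningCycle (V G)
  cycleOf t = proj₁ (HamiltonianDecomposition.cycle DG t)

  even : ∀ t → parity (SpanningCycle.length (cycleOf t)) ≡ true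
  -- A spanning cycle of `G` has as many positions as `G` has vertices.
  even t = trans (cong parity (trans (↔⇒≡ (↔-sym (Digraph.enumeration G) ↔-∘ SpanningCycle.vertices (cycleOf t))) order≡))
                 (parity-double n)

  e₀ : V H
  e₀ = Successors.Cycle.at DH zero 0

  square : StarSquare (Fan.fan DH e₀)
  square = starSquare (Digraph._≟_ H) (Digraph.enumeration H) (1<#cycles DH (s≤s z≤n) ¬cycle)
    (Fan.#cycles+2≤order DH ¬complete) (Fan.fan DH e₀) (Fan.fan-injective DH e₀)
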